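{- Let $p$ be a prime and suppose $q\in U^{(1)}$. Then the number of fixed points for $[\iota_q]_{p^n}$ is asymptotically stable (that is, constant for all large enough $n$) for all $q$ and all $p$, except when $p=3$ and $q=q_0$ or $q=q_1$, in which case the number grows without bound as $n$ goes to infinity.
   Context: $\mathbb{Z}_p$ is the ring of $p$-adic integers and $U^{(m)}=1+p^m\mathbb{Z}_p$. For $q\in U^{(1)}$, $\iota_q:\mathbb{Z}_p\to\mathbb{Z}_p$ is the unique continuous function with $\iota_q(k)=1+q+\cdots+q^{k-1}$ for all integers $k\ge 0$, and $[\iota_q]_{p^n}:\mathbb{Z}_p\to\mathbb{Z}/p^n\mathbb{Z}$ is its reduction modulo $p^n$. A fixed point of $[\iota_q]_{p^n}$ is an element $z\in\mathbb{Z}_p$ with $\iota_q(z)\equiv z\pmod{p^n}$; fixed points are counted modulo $p^n\mathbb{Z}_p$. Every $\iota_q$ fixes $0$ and $1$ (the trivial fixed points). For $p=3$, $q_0$ and $q_1$ denote the unique elements of $U^{(1)}-U^{(2)}$ with $q_0\equiv 7\pmod 9$ and $q_1\equiv 4\pmod 9$ such that $\iota_{q_0}$ and $\iota_{q_1}$ have no nontrivial fixed points in $\mathbb{Z}_3$ (their existence and uniqueness is a result of the same paper).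
   Formalization: The case q = 1 is excluded from the stability claim, since there ι_q is the identity and the number of fixed points is p^n; "q ≠ 1, q₀, q₁" is read as differing modulo some explicit power of p, which is classically equivalent. -}

module Defs where

open import Data.Integer.Base as ℤ using (+_)
import Data.Integer.Divisibility.Signed as ℤ∣
import Data.Integer.Properties as ℤₚ
import Data.Integer.Tactic.RingSolver as ℤSolver
open import Data.List.Base using (filter; length; upTo)
open import Data.Nat.Base
open import Data.Nat.Divisibility
  using (_∣_; divides; ∣-trans; 1∣_; *-pres-∣; ∣m⇒∣m*n; >⇒∤)
open import Data.Nat.DivMod using (_%_; _/_; m≡m%n+[m/n]*n; m%n<n)
open import Data.Nat.Properties
open import Data.Nat.Tactic.RingSolver using (solve-∀)
open import Data.Product.Base using (Σ-syntax; ∃-syntax; _×_; _,_)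
open import Data.Sum.Base using (inj₁; inj₂)
open import Function.Base using (_$_)
open import Relation.Binary.Definitions using (tri<; tri≈; tri>)
open import Relation.Binary.PropositionalEquality
open import Relation.Nullary.Decidable.Core using (map′)
open import Relation.Nullary using (¬_; Dec; contradiction)

private variable
  p m : ℕ

infix 4 _≡_[mod_]

record _≡_[mod_] (a b m : ℕ) : Set where
  constructor cong-mod
  field ∣-difference : + m ℤ∣.∣ + a ℤ.- + b

open _≡_[mod_] public

mod-reflexive : ∀ {a b} → a ≡ b → a ≡ b [mod m ]
mod-reflexive {a = a} refl = cong-mod (ℤ∣.divides (+ 0) (ℤₚ.+-inverseʳ (+ a)))

mod-refl : ∀ {a} → a ≡ a [mod m ]
mod-refl = mod-reflexive refl

mod-sym : ∀ {a b} → a ≡ b [mod m ] → b ≡ a [mod m ]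
mod-sym {m} {a} {b} (cong-mod h) =
  cong-mod (subst (+ m ℤ∣.∣_) (eq (+ a) (+ b)) (ℤ∣.∣m⇒∣-m h))
  where
  eq : ∀ x y → ℤ.- (x ℤ.- y) ≡ y ℤ.- x
  eq = ℤSolver.solve-∀

mod-trans : ∀ {a b c} → a ≡ b [mod m ] → b ≡ c [mod m ] → a ≡ c [mod m ]
mod-trans {m} {a} {b} {c} (cong-mod h) (cong-mod g) =
  cong-mod (subst (+ m ℤ∣.∣_) (eq (+ a) (+ b) (+ c)) (ℤ∣.∣m∣n⇒∣m+n h g))
  where
  eq : ∀ x y z → (x ℤ.- y) ℤ.+ (y ℤ.- z) ≡ x ℤ.- z
  eq = ℤSolver.solve-∀

mod-+ : ∀ {a b c d} → a ≡ b [mod m ] → c ≡ d [mod m ] → a + c ≡ b + d [mod m ]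
mod-+ {m} {a} {b} {c} {d} (cong-mod h) (cong-mod g) =
  cong-mod (subst (+ m ℤ∣.∣_)
    (trans (eq (+ a) (+ b) (+ c) (+ d))
           (sym (cong₂ ℤ._-_ (ℤₚ.pos-+ a c) (ℤₚ.pos-+ b d))))
    (ℤ∣.∣m∣n⇒∣m+n h g))
  where
  eq : ∀ x y z w → (x ℤ.- y) ℤ.+ (z ℤ.- w) ≡ (x ℤ.+ z) ℤ.- (y ℤ.+ w)
  eq = ℤSolver.solve-∀

mod-* : ∀ {a b c d} → a ≡ b [mod m ] → c ≡ d [mod m ] → a * c ≡ b * d [mod m ]
mod-* {m} {a} {b} {c} {d} (cong-mod h) (cong-mod g) =
  cong-mod (subst (+ m ℤ∣.∣_)
    (trans (eq (+ a) (+ b) (+ c) (+ d))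
           (sym (cong₂ ℤ._-_ (ℤₚ.pos-* a c) (ℤₚ.pos-* b d))))
    (ℤ∣.∣m∣n⇒∣m+n (ℤ∣.∣n⇒∣m*n (+ c) h) (ℤ∣.∣n⇒∣m*n (+ b) g)))
  where
  eq : ∀ x y z w → z ℤ.* (x ℤ.- y) ℤ.+ y ℤ.* (z ℤ.- w) ≡ (x ℤ.* z) ℤ.- (y ℤ.* w)
  eq = ℤSolver.solve-∀

mod-^ : ∀ {a b} k → a ≡ b [mod m ] → a ^ k ≡ b ^ k [mod m ]
mod-^ zero    h = mod-refl
mod-^ (suc k) h = mod-* h (mod-^ k h)

mod-weaken : ∀ {k a b} → k ∣ m → a ≡ b [mod m ] → a ≡ b [mod k ]
mod-weaken k∣m (cong-mod h) = cong-mod (ℤ∣.∣-trans (ℤ∣.∣ᵤ⇒∣ k∣m) h)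

mod-1 : ∀ {a b} → a ≡ b [mod 1 ]
mod-1 = cong-mod (ℤ∣.∣ᵤ⇒∣ (1∣ _))

∣⇒mod-0 : ∀ {a} → m ∣ a → a ≡ 0 [mod m ]
∣⇒mod-0 {m} {a} h =
  cong-mod (subst (+ m ℤ∣.∣_) (sym (ℤₚ.+-identityʳ (+ a))) (ℤ∣.∣ᵤ⇒∣ h))

mod-0⇒∣ : ∀ {a} → a ≡ 0 [mod m ] → m ∣ a
mod-0⇒∣ {m} {a} (cong-mod h) =
  ℤ∣.∣⇒∣ᵤ (subst (+ m ℤ∣.∣_) (ℤₚ.+-identityʳ (+ a)) h)

mod⇒∣∸ : ∀ {a b} → b ≤ a → a ≡ b [mod m ] → m ∣ a ∸ b
mod⇒∣∸ {m} {a} {b} b≤a (cong-mod h) =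
  ℤ∣.∣⇒∣ᵤ (subst (+ m ℤ∣.∣_) (trans (ℤₚ.m-n≡m⊖n a b) (ℤₚ.⊖-≥ b≤a)) h)

-- The p-adic integers as the inverse limit of the rings ℤ/pⁿℤ.  The
-- residue class at level n is given by any natural number representing
-- it; two sequences of representatives are identified by _≈_.
record ℤ[_] (p : ℕ) : Set where
  field
    res      : ℕ → ℕ
    coherent : ∀ n → res (suc n) ≡ res n [mod p ^ n ]

open ℤ[_] public

infix 4 _≡_[mod^_] _≈_ _#_

-- x - y ∈ pⁿℤ_p, since pⁿℤ_p is the kernel of the projection to ℤ/pⁿℤ.
_≡_[mod^_] : ℤ[ p ] → ℤ[ p ] → ℕ → Set
_≡_[mod^_] {p} x y n = res x n ≡ res y n [mod p ^ n ]

_≡?_[mod^_] : (x y : ℤ[ p ]) (n : ℕ) → Dec (x ≡ y [mod^ n ])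
_≡?_[mod^_] {p} x y n = map′ cong-mod ∣-difference $ + (p ^ n) ℤ∣.∣? (+ res x n ℤ.- + res y n)

_≈_ : ℤ[ p ] → ℤ[ p ] → Set
x ≈ y = ∀ n → x ≡ y [mod^ n ]

-- The constructive form of x ≠ y: a precision at which x and y differ is
-- given.  Classically it is equivalent to ¬ (x ≈ y).
_#_ : ℤ[ p ] → ℤ[ p ] → Set
x # y = ∃[ n ] ¬ (x ≡ y [mod^ n ])

fromℕ : ℕ → ℤ[ p ]
fromℕ k = record { res = λ _ → k ; coherent = λ _ → mod-refl }

infixl 6 _⊕_
infixl 7 _⊗_

_⊕_ : ℤ[ p ] → ℤ[ p ] → ℤ[ p ]
x ⊕ y = record
  { res      = λ n → res x n + res y n
  ; coherent = λ n → mod-+ (coherent x n) (coherent y n)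
  }

_⊗_ : ℤ[ p ] → ℤ[ p ] → ℤ[ p ]
x ⊗ y = record
  { res      = λ n → res x n * res y n
  ; coherent = λ n → mod-* (coherent x n) (coherent y n)
  }

pow : ℤ[ p ] → ℕ → ℤ[ p ]
pow x zero    = fromℕ 1
pow x (suc k) = x ⊗ pow x k

infix 4 _∈U_

_∈U_ : ℤ[ p ] → ℕ → Set
q ∈U m = q ≡ fromℕ 1 [mod^ m ]

geomℕ : ℕ → ℕ → ℕ
geomℕ q zero    = 0
geomℕ q (suc k) = geomℕ q k + q ^ k

geom : ℤ[ p ] → ℕ → ℤ[ p ]
geom q zero    = fromℕ 0
geom q (suc k) = geom q k ⊕ pow q k

geomℕ-+ : ∀ q a b → geomℕ q (a + b) ≡ geomℕ q a + q ^ a * geomℕ q b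
geomℕ-+ q a zero
  rewrite +-identityʳ a | *-zeroʳ (q ^ a) = sym (+-identityʳ _)
geomℕ-+ q a (suc b)
  rewrite +-suc a b | geomℕ-+ q a b | ^-distribˡ-+-* q a b =
  eq (geomℕ q a) (q ^ a) (geomℕ q b) (q ^ b)
  where
  eq : ∀ x y z w → x + y * z + y * w ≡ x + y * (z + w)
  eq = solve-∀

geomℕ-* : ∀ q a b → geomℕ q (a * b) ≡ geomℕ q a * geomℕ (q ^ a) b
geomℕ-* q a zero rewrite *-zeroʳ a = sym (*-zeroʳ (geomℕ q a))
geomℕ-* q a (suc b)
  rewrite *-suc a b | +-comm a (a * b) | geomℕ-+ q (a * b) a
        | geomℕ-* q a b | sym (^-*-assoc q a b) =
  eq (geomℕ q a) (geomℕ (q ^ a) b) ((q ^ a) ^ b)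
  where
  eq : ∀ x y z → x * y + z * x ≡ x * (y + z)
  eq = solve-∀

mod-geomℕ : ∀ {a b} k → a ≡ b [mod m ] → geomℕ a k ≡ geomℕ b k [mod m ]
mod-geomℕ zero    h = mod-refl
mod-geomℕ (suc k) h = mod-+ (mod-geomℕ k h) (mod-^ k h)

geomℕ-1 : ∀ k → geomℕ 1 k ≡ k
geomℕ-1 zero = refl
geomℕ-1 (suc k) rewrite geomℕ-1 k | ^-zeroˡ k = +-comm k 1

p∣geomℕ : ∀ {q} → q ≡ 1 [mod p ] → p ∣ geomℕ q p
p∣geomℕ {p} q≡1 = mod-0⇒∣
  (mod-trans (mod-geomℕ p q≡1)
  (mod-trans (mod-reflexive (geomℕ-1 p)) (∣⇒mod-0 (divides 1 (sym (+-identityʳ p))))))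

pⁿ∣geomℕ : ∀ {q} n → q ≡ 1 [mod p ] → p ^ n ∣ geomℕ q (p ^ n)
pⁿ∣geomℕ zero q≡1 = 1∣ _
pⁿ∣geomℕ {p} {q} (suc n) q≡1 =
  subst₂ _∣_ (*-comm (p ^ n) p)
    (trans (sym (geomℕ-* q (p ^ n) p)) (cong (geomℕ q) (*-comm (p ^ n) p)))
    (*-pres-∣ (pⁿ∣geomℕ n q≡1)
      (p∣geomℕ (mod-trans (mod-^ (p ^ n) q≡1)
                          (mod-reflexive (^-zeroˡ (p ^ n))))))

geomℕ-index-≤ : ∀ {q a b} n → q ≡ 1 [mod p ] → b ≤ a →
                a ≡ b [mod p ^ n ] → geomℕ q a ≡ geomℕ q b [mod p ^ n ]
geomℕ-index-≤ {p} {q} {a} {b} n q≡1 b≤a h with mod⇒∣∸ b≤a h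
... | divides c eq =
  mod-trans (mod-reflexive (trans (cong (geomℕ q) a≡) (geomℕ-+ q b (p ^ n * c))))
    (mod-trans
      (mod-+ (mod-refl {a = geomℕ q b})
             (mod-* (mod-refl {a = q ^ b}) (∣⇒mod-0 pⁿ∣)))
      (mod-reflexive (trans (cong (λ x → geomℕ q b + x) (*-zeroʳ (q ^ b)))
                            (+-identityʳ _))))
  where
  a≡ : a ≡ b + p ^ n * c
  a≡ = trans (sym (m+[n∸m]≡n b≤a)) (cong (λ x → b + x) (trans eq (*-comm c (p ^ n))))

  pⁿ∣ : p ^ n ∣ geomℕ q (p ^ n * c)
  pⁿ∣ = subst (p ^ n ∣_) (sym (geomℕ-* q (p ^ n) c)) (∣m⇒∣m*n _ (pⁿ∣geomℕ n q≡1))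

geomℕ-index : ∀ {q a b} n → q ≡ 1 [mod p ] →
              a ≡ b [mod p ^ n ] → geomℕ q a ≡ geomℕ q b [mod p ^ n ]
geomℕ-index {a = a} {b} n q≡1 h with ≤-total b a
... | inj₁ b≤a = geomℕ-index-≤ n q≡1 b≤a h
... | inj₂ a≤b = mod-sym (geomℕ-index-≤ n q≡1 a≤b (mod-sym h))

res-∈U : {q : ℤ[ p ]} → q ∈U 1 → ∀ n → res q (suc n) ≡ 1 [mod p ]
res-∈U {p} {q} u zero = mod-weaken (divides 1 (*-comm p 1)) u
res-∈U {p} {q} u (suc n) =
  mod-trans (mod-weaken (divides (p ^ n) (*-comm p (p ^ n))) (coherent q (suc n)))
            (res-∈U {q = q} u n)

-- Modulo pⁿ the sum 1 + q + ⋯ + qᵏ⁻¹ depends only on q mod pⁿ and, for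
-- q ∈ U⁽¹⁾, on k mod pⁿ, so its continuous extension can be computed from
-- the residues of q and z.  It is characterised by ι-fromℕ, ι-continuous
-- and ι-unique below.
ι : (q : ℤ[ p ]) → q ∈U 1 → ℤ[ p ] → ℤ[ p ]
ι q u z = record
  { res      = λ n → geomℕ (res q n) (res z n)
  ; coherent = λ n →
      mod-trans (geomℕ-index n (res-∈U {q = q} u n) (coherent z n))
                (mod-geomℕ (res z n) (coherent q n))
  }

Continuous : (ℤ[ p ] → ℤ[ p ]) → Set
Continuous {p} f = ∀ x n → ∃[ m ] (∀ y → x ≡ y [mod^ m ] → f x ≡ f y [mod^ n ])

ι-mod : (q : ℤ[ p ]) (u : q ∈U 1) → ∀ n x y →
        x ≡ y [mod^ n ] → ι q u x ≡ ι q u y [mod^ n ]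
ι-mod q u zero    x y h = mod-1
ι-mod q u (suc n) x y h = geomℕ-index (suc n) (res-∈U {q = q} u n) h

ι-continuous : (q : ℤ[ p ]) (u : q ∈U 1) → Continuous (ι q u)
ι-continuous q u x n = n , λ y → ι-mod q u n x y

ι-fromℕ : (q : ℤ[ p ]) (u : q ∈U 1) → ∀ k → ι q u (fromℕ k) ≈ geom q k
ι-fromℕ q u k n = mod-reflexive (lemma k)
  where
  pow-res : ∀ k → res q n ^ k ≡ res (pow q k) n
  pow-res zero    = refl
  pow-res (suc k) = cong (res q n *_) (pow-res k)

  lemma : ∀ k → geomℕ (res q n) k ≡ res (geom q k) n
  lemma zero    = refl
  lemma (suc k) = cong₂ _+_ (lemma k) (pow-res k)

res-stable : (x : ℤ[ p ]) → ∀ n d → res x (d + n) ≡ res x n [mod p ^ n ]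
res-stable x n zero = mod-refl
res-stable {p} x n (suc d) =
  mod-trans (mod-weaken (divides (p ^ d) (^-distribˡ-+-* p d n)) (coherent x (d + n)))
            (res-stable x n d)

ι-unique : (q : ℤ[ p ]) (u : q ∈U 1) (f : ℤ[ p ] → ℤ[ p ]) → Continuous f →
           (∀ k → f (fromℕ k) ≈ geom q k) → ∀ z → f z ≈ ι q u z
ι-unique {p} q u f cont interp z n with cont z n
... | m , close =
  mod-trans (close (fromℕ k) z≡k[m])
  (mod-trans (interp k n)
  (mod-trans (mod-sym (ι-fromℕ q u k n))
             (ι-mod q u n (fromℕ k) z (res-stable z n m))))
  where
  k : ℕ
  k = res z (m + n)

  z≡k[m] : z ≡ fromℕ k [mod^ m ]
  z≡k[m] = mod-sym (subst (λ i → res z i ≡ res z m [mod p ^ m ])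
                          (+-comm n m) (res-stable z m n))

FixedMod : (q : ℤ[ p ]) → q ∈U 1 → ℕ → ℤ[ p ] → Set
FixedMod q u n z = ι q u z ≡ z [mod^ n ]

-- The number of fixed points of [ι_q] modulo pⁿ, counted on the system of
-- representatives 0, 1, …, pⁿ - 1 of ℤ_p modulo pⁿℤ_p; the next three
-- lemmas say that this is a count of residue classes.
#Fixed : (q : ℤ[ p ]) → q ∈U 1 → ℕ → ℕ
#Fixed {p} q u n =
  length (filter (λ a → ι q u (fromℕ a) ≡? fromℕ a [mod^ n ]) (upTo (p ^ n)))

FixedMod-resp : (q : ℤ[ p ]) (u : q ∈U 1) → ∀ n x y →
                x ≡ y [mod^ n ] → FixedMod q u n x → FixedMod q u n y
FixedMod-resp q u n x y h fx =
  mod-trans (mod-sym (ι-mod q u n x y h)) (mod-trans fx h)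

representative : .{{_ : NonZero p}} → (z : ℤ[ p ]) → ∀ n →
                 ∃[ a ] (a < p ^ n × z ≡ fromℕ a [mod^ n ])
representative {p} z n = r % p ^ n , m%n<n r (p ^ n) ,
  mod-trans (mod-reflexive (m≡m%n+[m/n]*n r (p ^ n)))
    (mod-trans (mod-+ (mod-refl {a = r % p ^ n}) (∣⇒mod-0 (divides (r / p ^ n) refl)))
               (mod-reflexive (+-identityʳ _)))
  where
  r = res z n
  instance _ = m^n≢0 p n

representative-unique : ∀ n {a b} → a < p ^ n → b < p ^ n →
                        fromℕ {p} a ≡ fromℕ b [mod^ n ] → a ≡ b
representative-unique {p} n {a} {b} a< b< h with <-cmp a b
... | tri≈ _ a≡b _ = a≡b
... | tri< a<b _ _ = contradiction (mod⇒∣∸ (<⇒≤ a<b) (mod-sym h))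
  (>⇒∤ {{>-nonZero (m<n⇒0<n∸m a<b)}} (≤-<-trans (m∸n≤m b a) b<))
... | tri> _ _ b<a = contradiction (mod⇒∣∸ (<⇒≤ b<a) h)
  (>⇒∤ {{>-nonZero (m<n⇒0<n∸m b<a)}} (≤-<-trans (m∸n≤m a b) a<))

AsymptoticallyStable : (ℕ → ℕ) → Set
AsymptoticallyStable f = ∃[ N ] (∀ n → N ≤ n → f n ≡ f N)

GrowsWithoutBound : (ℕ → ℕ) → Set
GrowsWithoutBound f = ∀ B → ∃[ N ] (∀ n → N ≤ n → B ≤ f n)

NoNontrivialFixedPoint : (q : ℤ[ p ]) → q ∈U 1 → Set
NoNontrivialFixedPoint {p} q u =
  ¬ (Σ[ z ∈ ℤ[ p ] ] (ι q u z ≈ z × ¬ (z ≈ fromℕ 0) × ¬ (z ≈ fromℕ 1)))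

-- The property singling out q₀ (for r = 7) and q₁ (for r = 4).
IsExceptional : ℕ → ℤ[ 3 ] → Set
IsExceptional r q =
  Σ[ u ∈ q ∈U 1 ] (¬ (q ∈U 2) × q ≡ fromℕ r [mod^ 2 ] × NoNontrivialFixedPoint q u)

{-# OPTIONS --safe #-}

-- Put t = q - 1, F(z) = ι_q(z) - z and pᵐ ‖ t.  Unless p = 3 and m = 1,
-- 2F(z) ≡ t z(z - 1) modulo pᵐ⁺¹, and differences of 2F at points congruent
-- modulo p follow the same quadratic to one further digit.  So zeros of F
-- are simple modulo p after division by pᵐ, and Hensel's lemma makes their
-- number modulo pⁿ eventually constant.
--
-- For p = 3 and t = 3s with s a unit, F(r + 3ⁱy) = F(r) + 3ⁱ Hᵢ(y), where
-- Hᵢ(y) = Aᵢ (1 + qᵢ + ⋯ + qᵢʸ⁻¹) - y and qᵢ = q^(3ⁱ).  Write r for the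
-- fixed point 0 or 1 at which F′ vanishes modulo 9.  As long as Aᵢ ≡ 1
-- modulo 3ⁱ⁺¹, the function Hᵢ is quadratic in the sense above, and either
-- its zeros are simple, one of them giving a nontrivial fixed point of ι_q,
-- or they are all divisible by 3 and one passes to Hᵢ₊₁.  If this never
-- stops, then r is a double zero of F and r + 3ⁱy is fixed modulo 3²ⁱ⁺¹ for
-- all y.  Since Aᵢ determines q modulo 3ⁱ⁺¹, this happens for one q only.
module Submission where

open import Defs
open import Data.Bool.Base using (if_then_else_)
open import Data.Integer.Base
  using (ℤ; +_; _+_; _*_; _-_; -_; _^_; NonZero; ≢-nonZero) renaming (∣_∣ to abs)
open import Data.Integer.DivMod using (_%ℕ_; _/ℕ_; a≡a%ℕn+[a/ℕn]*n; n%ℕd<d)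
open import Data.Integer.Divisibility.Signed
  using (_∣_; divides; quotient; _∣?_; ∣ᵤ⇒∣; ∣⇒∣ᵤ; ∣-trans; ∣-refl; ∣m∣n⇒∣m+n; ∣m∣n⇒∣m-n;
         ∣m⇒∣-m; ∣n⇒∣m*n; ∣m⇒∣m*n; *-monoʳ-∣; *-cancelˡ-∣; m∣∣m∣)
import Data.Integer.Properties as ℤₚ
open import Data.Integer.Tactic.RingSolver using (solve-∀)
open import Data.List.Base using (filter; length; applyUpTo)
open import Data.Nat.Base as ℕ using (ℕ; zero; suc; _≤_; _<_; z≤n; s≤s; ⌊_/2⌋; ⌈_/2⌉)
import Data.Nat.Coprimality as Coprimality
import Data.Nat.Divisibility as ℕ∣
import Data.Nat.GCD as GCD
open import Data.Nat.Primality
  using (Prime; prime?; euclidsLemma; prime⇒irreducible; prime⇒nonZero; prime⇒nonTrivial)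
import Data.Nat.Properties as ℕₚ
import Data.Nat.Tactic.RingSolver as ℕSolver
open import Data.Product.Base using (Σ-syntax; ∃-syntax; _×_; _,_; proj₁; proj₂)
open import Data.Sum.Base using (_⊎_; inj₁; inj₂; [_,_]′; map)
open import Function.Base using (_∘_; id)
open import Function.Bundles using (mk⇔)
open import Relation.Binary.PropositionalEquality
open import Relation.Nullary using (¬_; Dec; yes; no; contradiction; does)
open import Relation.Nullary.Decidable using (does-⇔; dec-true; dec-false; from-yes; from-no)

-- For `p = 3` and `t = 3s` the term `C(a,3) t²` of the expansion of `F` can be as large as
-- `C(a,2) t`, so `F` itself has no quadratic model. On a progression of step `3ⁱ` with `i ≥ 1` the
-- parameter `q` is replaced by `qᵢ`, where `qᵢ - 1` is divisible by 9. The price is the factor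
-- `Aᵢ`, which tends to the derivative of `ι_q` at `r`. The doubling of `F` avoids dividing by 2 in
-- `C(a,2)`; for `p = 2` it costs one digit of precision. As `q` is given by residues only, the
-- arguments concern the integers `T q n`, with bounds independent of `n`. The digit at which `q`
-- differs from 1 bounds the valuation of `q - 1`; those at which it differs from `q₀` and `q₁`
-- bound the number of stages. Absence of fixed points is a negation; it becomes usable because each
-- stage is settled by a decidable divisibility.

combine₁ : ∀ {l r a b : ℤ} k → a ≡ b → l ≡ r + k * (a - b) → l ≡ r
combine₁ {r = r} {a} k refl e = trans e (eq r k a)
  where
  eq : ∀ r k a → r + k * (a - a) ≡ r
  eq = solve-∀

-- Hypotheses enter as multiples of the differences of their two sides. Once the multipliers are
-- named, what remains is a polynomial identity for the ring solver.
combine₂ : ∀ {l r a b c d : ℤ} j k → a ≡ b → c ≡ d →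
           l ≡ r + j * (a - b) + k * (c - d) → l ≡ r
combine₂ j k e f g = combine₁ j e (combine₁ k f g)

-- Geometric sums as polynomials in `t = q - 1`

-- The sum 1 + q + ⋯ + qᵃ⁻¹ in the variable t = q - 1.
gz : ℤ → ℕ → ℤ
gz t zero    = + 0
gz t (suc a) = + 1 + (+ 1 + t) * gz t a

gz-+ : ∀ t a b → gz t (a ℕ.+ b) ≡ gz t a + gz t b + t * (gz t a * gz t b)
gz-+ t zero    b = eq t (gz t b)
  where
  eq : ∀ t y → y ≡ + 0 + y + t * (+ 0 * y)
  eq = solve-∀
gz-+ t (suc a) b = combine₁ (+ 1 + t) (gz-+ t a b) (eq t (gz t a) (gz t b) (gz t (a ℕ.+ b)))
  where
  eq : ∀ t x y z → + 1 + (+ 1 + t) * z ≡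
       (+ 1 + (+ 1 + t) * x) + y + t * ((+ 1 + (+ 1 + t) * x) * y)
       + (+ 1 + t) * (z - (x + y + t * (x * y)))
  eq = solve-∀

-- The terms are grouped into blocks of length `a`, with ratio `qᵃ = 1 + t * gz t a` from one block
-- to the next; so the inner sum has parameter `qᵃ - 1`.
gz-* : ∀ t a b → gz t (a ℕ.* b) ≡ gz t a * gz (t * gz t a) b
gz-* t a zero    = trans (cong (gz t) (ℕₚ.*-zeroʳ a)) (sym (ℤₚ.*-zeroʳ (gz t a)))
gz-* t a (suc b) =
  trans (cong (gz t) (ℕₚ.*-suc a b)) (combine₂ (+ 1) (+ 1 + t * gz t a)
    (gz-+ t a (a ℕ.* b)) (gz-* t a b)
    (eq t (gz t a) (gz (t * gz t a) b) (gz t (a ℕ.* b)) (gz t (a ℕ.+ a ℕ.* b))))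
  where
  eq : ∀ t x y z w → w ≡ x * (+ 1 + (+ 1 + t * x) * y)
       + + 1 * (w - (x + z + t * (x * z))) + (+ 1 + t * x) * (z - x * y)
  eq = solve-∀

gz-cong : ∀ {D t t′} a → D ∣ t - t′ → D ∣ gz t a - gz t′ a
gz-cong zero h = divides (+ 0) refl
gz-cong {D} {t} {t′} (suc a) h with h | gz-cong a h
... | divides k e | divides l f =
  divides (k * gz t a + (+ 1 + t′) * l)
    (combine₂ (gz t a) (+ 1 + t′) e f (eq t t′ (gz t a) (gz t′ a) k l D))
  where
  eq : ∀ t u x y k l D → (+ 1 + (+ 1 + t) * x) - (+ 1 + (+ 1 + u) * y) ≡
       (k * x + (+ 1 + u) * l) * D + x * (t - u - k * D) + (+ 1 + u) * (x - y - l * D)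
  eq = solve-∀

-- From the binomial expansion gz t a = Σₖ C(a,k) tᵏ⁻¹.
gz-expansion : ∀ t a → ∃[ c₂ ] ∃[ c₃ ] ∃[ r ]
  (+ 2 * c₂ ≡ + a * (+ a - + 1)) ×
  (+ 6 * c₃ ≡ + a * (+ a - + 1) * (+ a - + 2)) ×
  (gz t a ≡ + a + c₂ * t + c₃ * (t * t) + r * (t * t * t))
gz-expansion t zero = + 0 , + 0 , + 0 , refl , refl , eq t
  where
  eq : ∀ t → + 0 ≡ + 0 + + 0 * t + + 0 * (t * t) + + 0 * (t * t * t)
  eq = solve-∀
gz-expansion t (suc a) with gz-expansion t a
... | c₂ , c₃ , r , e₂ , e₃ , e =
  c₂ + + a , c₃ + c₂ , r + c₃ + r * t ,
  combine₁ (+ 1) e₂ (eq₂ (+ a) c₂) ,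
  combine₂ (+ 1) (+ 3) e₃ e₂ (eq₃ (+ a) c₂ c₃) ,
  combine₁ (+ 1 + t) e (eq t (+ a) c₂ c₃ r (gz t a))
  where
  eq₂ : ∀ a c → + 2 * (c + a) ≡ (+ 1 + a) * (+ 1 + a - + 1) + + 1 * (+ 2 * c - a * (a - + 1))
  eq₂ = solve-∀
  eq₃ : ∀ a c d → + 6 * (d + c) ≡ (+ 1 + a) * (+ 1 + a - + 1) * (+ 1 + a - + 2)
        + + 1 * (+ 6 * d - a * (a - + 1) * (a - + 2)) + + 3 * (+ 2 * c - a * (a - + 1))
  eq₃ = solve-∀
  eq : ∀ t a c d r g → + 1 + (+ 1 + t) * g ≡
       (+ 1 + a) + (c + a) * t + (d + c) * (t * t) + (r + d + r * t) * (t * t * t)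
       + (+ 1 + t) * (g - (a + c * t + d * (t * t) + r * (t * t * t)))
  eq = solve-∀

gz-expansion₁ : ∀ t a → ∃[ r ] (gz t a ≡ + a + t * r)
gz-expansion₁ t a with gz-expansion t a
... | c₂ , c₃ , r , _ , _ , e = c₂ + c₃ * t + r * (t * t) , trans e (eq t (+ a) c₂ c₃ r)
  where
  eq : ∀ t a c d r → a + c * t + d * (t * t) + r * (t * t * t) ≡ a + t * (c + d * t + r * (t * t))
  eq = solve-∀

gz-expansion₂ : ∀ t a → ∃[ r ] (+ 2 * gz t a ≡ + 2 * + a + t * (+ a * (+ a - + 1)) + t * t * r)
gz-expansion₂ t a with gz-expansion t a
... | c₂ , c₃ , r , e₂ , _ , e =
  + 2 * c₃ + + 2 * r * t , combine₂ (+ 2) t e e₂ (eq t (+ a) c₂ c₃ r (gz t a))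
  where
  eq : ∀ t a c d r g → + 2 * g ≡ + 2 * a + t * (a * (a - + 1)) + t * t * (+ 2 * d + + 2 * r * t)
       + + 2 * (g - (a + c * t + d * (t * t) + r * (t * t * t))) + t * (+ 2 * c - a * (a - + 1))
  eq = solve-∀

h : ℤ → ℤ → ℕ → ℤ
h A t y = A * gz t y - + y

F : ℤ → ℕ → ℤ
F t a = gz t a - + a

-- Counting roots

sumTo : (ℕ → ℕ) → ℕ → ℕ
sumTo f zero    = 0
sumTo f (suc n) = f 0 ℕ.+ sumTo (f ∘ suc) n

sumTo-cong : ∀ {f g} n → (∀ i → i < n → f i ≡ g i) → sumTo f n ≡ sumTo g n
sumTo-cong zero    h = refl
sumTo-cong (suc n) h =
  cong₂ ℕ._+_ (h 0 (s≤s z≤n)) (sumTo-cong n λ i i<n → h (suc i) (s≤s i<n))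

sumTo-const : ∀ c n → sumTo (λ _ → c) n ≡ n ℕ.* c
sumTo-const c zero    = refl
sumTo-const c (suc n) = cong (c ℕ.+_) (sumTo-const c n)

sumTo-zero : ∀ {f} n → (∀ i → i < n → f i ≡ 0) → sumTo f n ≡ 0
sumTo-zero n h = trans (sumTo-cong n h) (trans (sumTo-const 0 n) (ℕₚ.*-zeroʳ n))

sumTo-*ˡ : ∀ c f n → sumTo (λ i → c ℕ.* f i) n ≡ c ℕ.* sumTo f n
sumTo-*ˡ c f zero    = sym (ℕₚ.*-zeroʳ c)
sumTo-*ˡ c f (suc n) =
  trans (cong (c ℕ.* f 0 ℕ.+_) (sumTo-*ˡ c (f ∘ suc) n)) (sym (ℕₚ.*-distribˡ-+ c (f 0) _))

sumTo-++ : ∀ f m n → sumTo f (m ℕ.+ n) ≡ sumTo f m ℕ.+ sumTo (λ i → f (m ℕ.+ i)) n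
sumTo-++ f zero    n = refl
sumTo-++ f (suc m) n =
  trans (cong (f 0 ℕ.+_) (sumTo-++ (f ∘ suc) m n)) (sym (ℕₚ.+-assoc (f 0) _ _))

sumTo-+ : ∀ f g n → sumTo (λ i → f i ℕ.+ g i) n ≡ sumTo f n ℕ.+ sumTo g n
sumTo-+ f g zero    = refl
sumTo-+ f g (suc n) = trans (cong (f 0 ℕ.+ g 0 ℕ.+_) (sumTo-+ (f ∘ suc) (g ∘ suc) n))
  (eq (f 0) (g 0) _ _)
  where
  eq : ∀ a b c d → a ℕ.+ b ℕ.+ (c ℕ.+ d) ≡ a ℕ.+ c ℕ.+ (b ℕ.+ d)
  eq = ℕSolver.solve-∀

sumTo-split : ∀ f D M →
  sumTo f (D ℕ.* M) ≡ sumTo (λ r → sumTo (λ y → f (r ℕ.+ D ℕ.* y)) M) D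
sumTo-split f D zero = trans (cong (sumTo f) (ℕₚ.*-zeroʳ D)) (sym (sumTo-zero D λ _ _ → refl))
sumTo-split f D (suc M) =
  trans (cong (sumTo f) (ℕₚ.*-suc D M))
  (trans (sumTo-++ f D (D ℕ.* M))
  (trans (cong (sumTo f D ℕ.+_) (sumTo-split (λ i → f (D ℕ.+ i)) D M))
  (trans (sym (sumTo-+ f _ D))
         (sumTo-cong D λ r _ → cong₂ ℕ._+_
           (cong f (sym (trans (cong (r ℕ.+_) (ℕₚ.*-zeroʳ D)) (ℕₚ.+-identityʳ r))))
           (sumTo-cong M λ y _ → cong f (eq D r y))))))
  where
  eq : ∀ D r y → D ℕ.+ (r ℕ.+ D ℕ.* y) ≡ r ℕ.+ D ℕ.* suc y
  eq = ℕSolver.solve-∀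

indicator : {A : Set} → Dec A → ℕ
indicator a? = if does a? then 1 else 0

indicator-cong : {A B : Set} {a? : Dec A} {b? : Dec B} →
                 (A → B) → (B → A) → indicator a? ≡ indicator b?
indicator-cong {a? = a?} {b?} f g =
  cong (λ b → if b then 1 else 0) (does-⇔ (mk⇔ f g) a? b?)

indicator-true : {A : Set} (a? : Dec A) → A → indicator a? ≡ 1
indicator-true a? a = cong (λ b → if b then 1 else 0) (dec-true a? a)

indicator-false : {A : Set} (a? : Dec A) → ¬ A → indicator a? ≡ 0
indicator-false a? ¬a = cong (λ b → if b then 1 else 0) (dec-false a? ¬a)

sumTo-unique : {A : ℕ → Set} (A? : ∀ i → Dec (A i)) → ∀ n k → k < n → A k →
               (∀ i → i < n → A i → i ≡ k) → sumTo (λ i → indicator (A? i)) n ≡ 1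
sumTo-unique A? (suc n) zero _ a uniq =
  cong₂ ℕ._+_ (indicator-true (A? 0) a)
    (sumTo-zero n λ i i<n → indicator-false (A? (suc i)) λ b → contradiction (uniq (suc i) (s≤s i<n) b) λ ())
sumTo-unique A? (suc n) (suc k) (s≤s k<n) a uniq =
  cong₂ ℕ._+_ (indicator-false (A? 0) λ b → contradiction (uniq 0 (s≤s z≤n) b) λ ())
    (sumTo-unique (A? ∘ suc) n k k<n a λ i i<n b → ℕₚ.suc-injective (uniq (suc i) (s≤s i<n) b))

StableFrom : ℕ → (ℕ → ℕ) → Set
StableFrom N f = ∀ n → N ≤ n → f n ≡ f N

stableFrom-≤ : ∀ {M N f} → M ≤ N → StableFrom M f → StableFrom N f
stableFrom-≤ M≤N h n N≤n = trans (h n (ℕₚ.≤-trans M≤N N≤n)) (sym (h _ M≤N))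

length-filter : {A : ℕ → Set} (A? : ∀ i → Dec (A i)) (f : ℕ → ℕ) → ∀ n →
                length (filter A? (applyUpTo f n)) ≡ sumTo (λ i → indicator (A? (f i))) n
length-filter A? f zero = refl
length-filter A? f (suc n) with A? (f 0)
... | yes _ = cong suc (length-filter A? (f ∘ suc) n)
... | no  _ = length-filter A? (f ∘ suc) n

gz-geomℕ : ∀ Q a → gz (+ Q - + 1) a ≡ + geomℕ Q a
gz-geomℕ Q zero    = refl
gz-geomℕ Q (suc a) = sym
  (trans (cong +_ (trans (geomℕ-+ Q 1 a) (cong (λ k → 1 ℕ.+ k ℕ.* geomℕ Q a) (ℕₚ.^-identityʳ Q))))
  (trans (ℤₚ.pos-+ 1 (Q ℕ.* geomℕ Q a))
  (trans (cong (_+_ (+ 1)) (ℤₚ.pos-* Q (geomℕ Q a)))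
  (trans (cong (λ g → + 1 + + Q * g) (sym (gz-geomℕ Q a))) (eq (+ Q) _)))))
  where
  eq : ∀ Q g → + 1 + Q * g ≡ + 1 + (+ 1 + (Q - + 1)) * g
  eq = solve-∀

n≤3^n : ∀ n → n ≤ 3 ℕ.^ n
n≤3^n zero    = z≤n
n≤3^n (suc n) = ℕₚ.+-mono-≤ (ℕₚ.m^n>0 3 n) (ℕₚ.≤-trans (n≤3^n n) (ℕₚ.m≤m+n _ _))

term≤sumTo : ∀ f n i → i < n → f i ≤ sumTo f n
term≤sumTo f (suc n) zero    _         = ℕₚ.m≤m+n _ _
term≤sumTo f (suc n) (suc i) (s≤s i<n) = ℕₚ.≤-trans (term≤sumTo (f ∘ suc) n i i<n) (ℕₚ.m≤n+m _ (f 0))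

-- Quadratic approximation at a fixed prime

module AtPrime (p : ℕ) (pr : Prime p) where

  ϖ : ℤ
  ϖ = + p

  pos-^ : ∀ n → + (p ℕ.^ n) ≡ ϖ ^ n
  pos-^ zero    = refl
  pos-^ (suc n) = trans (ℤₚ.pos-* p (p ℕ.^ n)) (cong (ϖ *_) (pos-^ n))

  pos-^* : ∀ n a → + (p ℕ.^ n ℕ.* a) ≡ ϖ ^ n * + a
  pos-^* n a = trans (ℤₚ.pos-* (p ℕ.^ n) a) (cong (_* + a) (pos-^ n))

  -- True for P₀ = 2, for P₀ = p ≥ 5, and for P₀ = 9 when p = 3, but not for
  -- P₀ = 3, where the term C(3,3)t² is too large.
  Quadratic : ℤ → Set
  Quadratic P₀ = ∀ P t → P₀ ∣ P → P ∣ t →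
    ∃[ y ] (+ 2 * gz t p ≡ + 2 * ϖ + ϖ * (ϖ - + 1) * t + ϖ * ϖ * P * y)

  module _ {P₀} (ϖ∣P₀ : ϖ ∣ P₀) (quadratic : Quadratic P₀) where

    -- By `gz-*`, splitting off one factor `p` replaces `t` by `t * gz t p`, a multiple of `ϖ * P`.
    -- Hence the quadratic term of the induction hypothesis falls into the error, and the one in the
    -- conclusion comes from `quadratic`.
    gz-quadratic : ∀ j c P t → P₀ ∣ P → P ∣ t → let d = ϖ ^ j * + c in
      ∃[ s ] (+ 2 * gz t (p ℕ.^ j ℕ.* c) ≡ + 2 * d + t * (d * (d - + 1)) + ϖ * ϖ ^ j * P * s)
    gz-quadratic zero c P t P₀∣P (divides τ t≡) with gz-expansion₂ t c | ∣-trans ϖ∣P₀ P₀∣P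
    ... | r , e | divides π P≡ = π * τ * τ * r ,
      trans (cong (λ x → + 2 * gz t x) (ℕₚ.*-identityˡ c))
        (combine₂ (+ 1) (τ * τ * P * r) e P≡
          (combine₁ ((t + τ * P) * r) t≡ (eq t (+ c) r τ P π ϖ (gz t c))))
      where
      eq : ∀ t c r τ P π ϖ g → + 2 * g ≡
           + 2 * (+ 1 * c) + t * (+ 1 * c * (+ 1 * c - + 1)) + ϖ * + 1 * P * (π * τ * τ * r)
           + + 1 * (+ 2 * g - (+ 2 * c + t * (c * (c - + 1)) + t * t * r))
           + τ * τ * P * r * (P - π * ϖ)
           + (t + τ * P) * r * (t - τ * P)
      eq = solve-∀
    gz-quadratic (suc j) c P t P₀∣P P∣t@(divides τ t≡)
      with gz-expansion₁ t p | ∣-trans ϖ∣P₀ P₀∣P | quadratic P t P₀∣P P∣t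
    ... | r , e₁ | divides π P≡ | y , e₂ = step
      where
      g = gz t p
      k = + 1 + τ * π * r

      g≡ : g ≡ ϖ * k
      g≡ = combine₂ (+ 1) r e₁ t≡ (combine₁ (τ * r) P≡ (eq ϖ τ π r P t g))
        where
        eq : ∀ ϖ τ π r P t g → g ≡ ϖ * (+ 1 + τ * π * r)
             + + 1 * (g - (ϖ + t * r)) + r * (t - τ * P) + τ * r * (P - π * ϖ)
        eq = solve-∀

      t′≡ : t * g ≡ τ * k * (ϖ * P)
      t′≡ = trans (cong₂ _*_ t≡ g≡) (eq τ P ϖ k)
        where
        eq : ∀ τ P ϖ k → τ * P * (ϖ * k) ≡ τ * k * (ϖ * P)
        eq = solve-∀

      G = gz (t * g) (p ℕ.^ j ℕ.* c)

      step : ∃[ s ] (+ 2 * gz t (p ℕ.^ suc j ℕ.* c) ≡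
               + 2 * (ϖ ^ suc j * + c) + t * (ϖ ^ suc j * + c * (ϖ ^ suc j * + c - + 1))
               + ϖ * ϖ ^ suc j * P * s)
      step with gz-quadratic j c (ϖ * P) (t * g)
                  (∣n⇒∣m*n ϖ P₀∣P) (divides (τ * k) t′≡)
      ... | s , e =
        y * + c + k * k * τ * + c * (d - + 1) + τ * + c * (+ 1 - d) + ϖ * k * s ,
        trans (cong (λ x → + 2 * gz t x) (ℕₚ.*-assoc p (p ℕ.^ j) c))
          (trans (cong (+ 2 *_) (gz-* t p (p ℕ.^ j ℕ.* c)))
            (combine₂ g d e e₂ (combine₂ (t * g * Δ + ϖ * w * (ϖ * P) * s) (ϖ * k * Δ) g≡ t′≡
              (combine₁ (ϖ * ϖ * d * (+ 1 - d)) t≡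
                (eq ϖ P t τ k s y w (+ c) g (t * g) G)))))
        where
        w = ϖ ^ j
        d = w * + c
        Δ = d * (d - + 1)
        eq : ∀ ϖ P t τ k s y w c g t′ G → + 2 * (g * G) ≡
          + 2 * (ϖ * w * c) + t * (ϖ * w * c * (ϖ * w * c - + 1)) + ϖ * (ϖ * w) * P *
            (y * c + k * k * τ * c * (w * c - + 1) + τ * c * (+ 1 - w * c) + ϖ * k * s)
          + g * (+ 2 * G - (+ 2 * (w * c) + t′ * (w * c * (w * c - + 1)) + ϖ * w * (ϖ * P) * s))
          + w * c * (+ 2 * g - (+ 2 * ϖ + ϖ * (ϖ - + 1) * t + ϖ * ϖ * P * y))
          + (t′ * (w * c * (w * c - + 1)) + ϖ * w * (ϖ * P) * s) * (g - ϖ * k)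
          + ϖ * k * (w * c * (w * c - + 1)) * (t′ - τ * k * (ϖ * P))
          + ϖ * ϖ * (w * c) * (+ 1 - w * c) * (t - τ * P)
        eq = solve-∀

  module _ {P₀} (ϖ∣P₀ : ϖ ∣ P₀) (quadratic : Quadratic P₀) where

    h-quadratic : ∀ {P A t} α v → P₀ ∣ P → A ≡ + 1 + P * α → t ≡ P * v →
      ∀ y → ∃[ s ]
      (+ 2 * h A t y ≡ P * (+ y * (+ 2 * α - v + v * + y)) + ϖ * P * s)
    h-quadratic {P} α v P₀∣P refl refl y with gz-expansion₂ (P * v) y | ∣-trans ϖ∣P₀ P₀∣P
    ... | r , e | divides π P≡ =
      π * X , combine₂ (+ 1 + P * α) (P * X) e P≡ (eq P α v (+ y) r (gz (P * v) y) π ϖ)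
      where
      X = α * v * (+ y * (+ y - + 1)) + (+ 1 + P * α) * (v * v) * r
      eq : ∀ P α v y r g π ϖ → + 2 * ((+ 1 + P * α) * g - y) ≡
        P * (y * (+ 2 * α - v + v * y))
        + ϖ * P * (π * (α * v * (y * (y - + 1)) + (+ 1 + P * α) * (v * v) * r))
        + (+ 1 + P * α) * (+ 2 * g - (+ 2 * y + P * v * (y * (y - + 1)) + P * v * (P * v) * r))
        + P * (α * v * (y * (y - + 1)) + (+ 1 + P * α) * (v * v) * r) * (P - π * ϖ)
      eq = solve-∀

    -- The factor of `d` is the derivative of `y(2α - v + vy)`. The second-order term `v d²` carries
    -- `ϖ^(2j)`, which the error absorbs only for `j ≥ 1`; hence `j = suc i`.
    h-increment : ∀ {P A t} α v → P₀ ∣ P → A ≡ + 1 + P * α → t ≡ P * v →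
      ∀ i y e → let j = suc i; d = ϖ ^ j * + e in ∃[ s ]
      (+ 2 * h A t (y ℕ.+ p ℕ.^ j ℕ.* e) - + 2 * h A t y ≡
       P * (d * (+ 2 * α - v + + 2 * v * + y)) + ϖ * ϖ ^ j * P * s)
    h-increment {P} α v P₀∣P refl refl i y e =
      + 2 * π * X * + e + v * w * + e * + e + π * Z * v * + e * (d - + 1) + s * (+ 1 + P * Z) ,
      trans (cong (λ x → + 2 * (A * gz t (y ℕ.+ D) - x) - + 2 * h A t y) y+D≡)
        (combine₂ (+ 2 * A) (A * (+ 1 + t * gz t y)) (gz-+ t y D) (proj₂ quad)
          (combine₂ (A * t * K) (P * (+ 2 * X * d + Z * v * (d * (d - + 1)))) (proj₂ expansion) (_∣_.equality ϖ∣P)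
            (eq P α v (+ y) r (gz t y) π ϖ w (+ e) s (gz t D) (gz t (y ℕ.+ D)))))
      where
      A = + 1 + P * α
      t = P * v
      expansion = gz-expansion₁ t y
      ϖ∣P = ∣-trans ϖ∣P₀ P₀∣P
      quad = gz-quadratic ϖ∣P₀ quadratic (suc i) e P t P₀∣P (divides v (ℤₚ.*-comm P v))
      r = proj₁ expansion
      π = quotient ϖ∣P
      s = proj₁ quad
      D = p ℕ.^ suc i ℕ.* e
      w = ϖ ^ i
      d = ϖ * w * + e
      X = v * v * r + α * v * (+ y + P * v * r)
      Z = α + v * + y + P * X
      K = + 2 * d + t * (d * (d - + 1)) + ϖ * (ϖ * w) * P * s
      y+D≡ : + (y ℕ.+ D) ≡ + y + d
      y+D≡ = trans (ℤₚ.pos-+ y D) (cong (_+_ (+ y)) (pos-^* (suc i) e))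
      eq : ∀ P α v y r g π ϖ w e s gD gyD →
        let d = ϖ * w * e
            X = v * v * r + α * v * (y + P * v * r)
            Z = α + v * y + P * X
            K = + 2 * d + P * v * (d * (d - + 1)) + ϖ * (ϖ * w) * P * s
            A = + 1 + P * α in
        + 2 * (A * gyD - (y + d)) - + 2 * (A * g - y) ≡
        P * (d * (+ 2 * α - v + + 2 * v * y)) + ϖ * (ϖ * w) * P *
          (+ 2 * π * X * e + v * w * e * e + π * Z * v * e * (d - + 1) + s * (+ 1 + P * Z))
        + + 2 * A * (gyD - (g + gD + P * v * (g * gD)))
        + A * (+ 1 + P * v * g) * (+ 2 * gD - K)
        + A * (P * v) * K * (g - (y + P * v * r))
        + P * (+ 2 * X * d + Z * v * (d * (d - + 1))) * (P - π * ϖ)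
      eq = solve-∀

  -- Powers of `p` and linear congruences

  private instance
    p≢0 : ℕ.NonZero p
    p≢0 = prime⇒nonZero pr

  ϖ-nonZero : NonZero ϖ
  ϖ-nonZero = ≢-nonZero λ e → ℕₚ.m<n⇒n≢0 (ℕ.>-nonZero⁻¹ p) (ℤₚ.+-injective e)

  ϖ^-cancel : ∀ k {x y} → ϖ ^ k * x ∣ ϖ ^ k * y → x ∣ y
  ϖ^-cancel zero {x} {y} h = subst₂ _∣_ (ℤₚ.*-identityˡ x) (ℤₚ.*-identityˡ y) h
  ϖ^-cancel (suc k) {x} {y} h = ϖ^-cancel k
    (*-cancelˡ-∣ ϖ {{ϖ-nonZero}} (subst₂ _∣_ (ℤₚ.*-assoc ϖ (ϖ ^ k) x) (ℤₚ.*-assoc ϖ (ϖ ^ k) y) h))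

  ϖ^∣ϖ^* : ∀ n x → ϖ ^ n ∣ ϖ ^ n * x
  ϖ^∣ϖ^* n x = divides x (ℤₚ.*-comm (ϖ ^ n) x)

  ϖ∣⇒ϖ^suc∣ : ∀ n x → ϖ ∣ x → ϖ ^ suc n ∣ ϖ ^ n * x
  ϖ∣⇒ϖ^suc∣ n x h = subst (_∣ ϖ ^ n * x) (ℤₚ.*-comm (ϖ ^ n) ϖ) (*-monoʳ-∣ (ϖ ^ n) h)

  ϖ^suc∣⇒ϖ∣ : ∀ n x → ϖ ^ suc n ∣ ϖ ^ n * x → ϖ ∣ x
  ϖ^suc∣⇒ϖ∣ n x h = ϖ^-cancel n (subst (_∣ ϖ ^ n * x) (ℤₚ.*-comm ϖ (ϖ ^ n)) h)

  ϖ^∣ϖ^ : ∀ {m n} → m ≤ n → ϖ ^ m ∣ ϖ ^ n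
  ϖ^∣ϖ^ {m} {n} m≤n = divides (ϖ ^ (n ℕ.∸ m))
    (trans (cong (ϖ ^_) (sym (ℕₚ.m∸n+n≡m m≤n))) (ℤₚ.^-distribˡ-+-* ϖ (n ℕ.∸ m) m))

  ϖ^0∣ : ∀ x → ϖ ^ 0 ∣ x
  ϖ^0∣ x = divides x (sym (ℤₚ.*-identityʳ x))

  euclid : ∀ x y → ϖ ∣ x * y → ϖ ∣ x ⊎ ϖ ∣ y
  euclid x y h = map ∣ᵤ⇒∣ ∣ᵤ⇒∣
    (euclidsLemma (abs x) (abs y) pr (subst (p ℕ∣.∣_) (ℤₚ.abs-* x y) (∣⇒∣ᵤ h)))

  cancel-∤ : ∀ n {c} x → ¬ ϖ ∣ c → ϖ ^ n ∣ c * x → ϖ ^ n ∣ x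
  cancel-∤ zero    x ¬c h = ϖ^0∣ x
  cancel-∤ (suc n) {c} x ¬c h with euclid c x (∣-trans (∣m⇒∣m*n (ϖ ^ n) ∣-refl) h)
  ... | inj₁ c∣ = contradiction c∣ ¬c
  ... | inj₂ (divides y refl) =
    subst (ϖ ^ suc n ∣_) (ℤₚ.*-comm ϖ y)
      (*-monoʳ-∣ ϖ (cancel-∤ n y ¬c
        (*-cancelˡ-∣ ϖ {{ϖ-nonZero}} (subst (ϖ ^ suc n ∣_) (eq c y ϖ) h))))
    where
    eq : ∀ c y ϖ → c * (y * ϖ) ≡ ϖ * (c * y)
    eq = solve-∀

  inverse : ∀ U → ¬ ϖ ∣ U → ∃[ V ] (ϖ ∣ U * V - + 1)
  inverse U ¬U with m∣∣m∣ {U} | Coprimality.coprime-Bézout coprime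
    where
    coprime : Coprimality.Coprime p (abs U)
    coprime {d} (d∣p , d∣U) with prime⇒irreducible pr d∣p
    ... | inj₁ d≡1  = d≡1
    ... | inj₂ refl = contradiction (∣ᵤ⇒∣ d∣U) ¬U
  ... | divides q e | GCD.Bézout.+- x y f = - (+ y * q) , divides (- + x)
    (combine₂ (- + 1) (+ y)
      (trans (sym (trans (ℤₚ.pos-+ 1 (y ℕ.* abs U)) (cong (_+_ (+ 1)) (ℤₚ.pos-* y (abs U)))))
             (trans (cong +_ f) (ℤₚ.pos-* x p)))
      e (eq U (+ (abs U)) q (+ x) (+ y) ϖ))
    where
    eq : ∀ U a q x y ϖ → U * (- (y * q)) - + 1 ≡
         - x * ϖ + - + 1 * (+ 1 + y * a - x * ϖ) + y * (a - q * U)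
    eq = solve-∀
  ... | divides q e | GCD.Bézout.-+ x y f = + y * q , divides (+ x)
    (combine₂ (+ 1) (- + y)
      (trans (sym (ℤₚ.pos-* y (abs U))) (trans (cong +_ (sym f))
        (trans (ℤₚ.pos-+ 1 (x ℕ.* p)) (cong (_+_ (+ 1)) (ℤₚ.pos-* x p)))))
      e (eq U (+ (abs U)) q (+ x) (+ y) ϖ))
    where
    eq : ∀ U a q x y ϖ → U * (y * q) - + 1 ≡
         x * ϖ + + 1 * (y * a - (+ 1 + x * ϖ)) + - y * (a - q * U)
    eq = solve-∀

  linear-root : ∀ x U → ¬ ϖ ∣ U → ∃[ e ] (e < p × ϖ ∣ x + U * + e)
  linear-root x U ¬U with inverse U ¬U
  ... | V , divides k f = e , n%ℕd<d a p , divides (- (x * k) - U * (a /ℕ p))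
    (combine₂ (- U) (- x) (a≡a%ℕn+[a/ℕn]*n a p) f (eq x U V k (+ e) (a /ℕ p) ϖ))
    where
    a = - (x * V)
    e = a %ℕ p
    eq : ∀ x U V k e d ϖ → x + U * e ≡
         (- (x * k) - U * d) * ϖ + - U * (- (x * V) - (e + d * ϖ)) + - x * (U * V - + 1 - k * ϖ)
    eq = solve-∀

  linear-root-unique : ∀ x U → ¬ ϖ ∣ U → ∀ {d e} → d < p → e < p →
                       ϖ ∣ x + U * + d → ϖ ∣ x + U * + e → d ≡ e
  linear-root-unique x U ¬U {d} {e} d<p e<p hd he
    with euclid U (+ d - + e) (subst (ϖ ∣_) (eq x U (+ d) (+ e)) (∣m∣n⇒∣m-n hd he))
    where
    eq : ∀ x U d e → x + U * d - (x + U * e) ≡ U * (d - e)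
    eq = solve-∀
  ... | inj₁ ∣U  = contradiction ∣U ¬U
  ... | inj₂ d-e = representative-unique {p} 1 (bound d<p) (bound e<p)
        (cong-mod (subst (λ n → + n ∣ + d - + e) (sym (ℕₚ.^-identityʳ p)) d-e))
    where
    bound : ∀ {a} → a < p → a < p ℕ.^ 1
    bound = subst (_ <_) (sym (ℕₚ.^-identityʳ p))

  -- Hensel lifting and the number of roots

  Periodic : (ℕ → ℤ) → Set
  Periodic f = ∀ n x y → ϖ ^ n ∣ f (x ℕ.+ p ℕ.^ n ℕ.* y) - f x

  -- Hensel's condition for a derivative of valuation `w`: the unit `U` stands for the derivative at
  -- `x` divided by `ϖ ^ w`. It is asked at roots only, because elsewhere the derivative of the
  -- quadratic may vanish modulo `p`.
  Liftable : (ℕ → ℤ) → ℕ → ℕ → Set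
  Liftable f w j = ∀ x → ϖ ^ (j ℕ.+ w) ∣ f x → ∃[ U ] (¬ ϖ ∣ U ×
    (∀ e → ϖ ^ suc (j ℕ.+ w) ∣ f (x ℕ.+ p ℕ.^ j ℕ.* e) - f x - ϖ ^ (j ℕ.+ w) * (U * + e)))

  roots : (ℕ → ℤ) → ℕ → ℕ → ℕ
  roots f n k = sumTo (λ x → indicator (ϖ ^ k ∣? f x)) (p ℕ.^ n)

  lift-∣ : ∀ K a b x U e → b ≡ ϖ ^ K * x → ϖ ^ suc K ∣ a - b - ϖ ^ K * (U * e) →
           (ϖ ^ suc K ∣ a → ϖ ∣ x + U * e) × (ϖ ∣ x + U * e → ϖ ^ suc K ∣ a)
  lift-∣ K a b x U e refl h =
    (λ h′ → ϖ^suc∣⇒ϖ∣ K (x + U * e) (subst (ϖ ^ suc K ∣_) (eq a (ϖ ^ K) x (U * e)) (∣m∣n⇒∣m-n h′ h))) ,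
    (λ h′ → subst (ϖ ^ suc K ∣_) (eq′ a (ϖ ^ K) x (U * e))
              (∣m∣n⇒∣m+n h (ϖ∣⇒ϖ^suc∣ K (x + U * e) h′)))
    where
    eq : ∀ a P x u → a - (a - P * x - P * u) ≡ P * (x + u)
    eq = solve-∀
    eq′ : ∀ a P x u → a - P * x - P * u + P * (x + u) ≡ a
    eq′ = solve-∀

  ∣-weaken : ∀ {m n x} → m ≤ n → ϖ ^ n ∣ x → ϖ ^ m ∣ x
  ∣-weaken m≤n = ∣-trans (ϖ^∣ϖ^ m≤n)

  ∣-cancel-term : ∀ {D a b} → D ∣ a - b → D ∣ b → D ∣ a
  ∣-cancel-term {D} {a} {b} h h′ = subst (D ∣_) (eq a b) (∣m∣n⇒∣m+n h h′)
    where
    eq : ∀ a b → a - b + b ≡ a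
    eq = solve-∀

  ∣-cancel-term′ : ∀ {D a b} → D ∣ a - b → D ∣ a → D ∣ b
  ∣-cancel-term′ {D} {a} {b} h h′ = subst (D ∣_) (eq a b) (∣m∣n⇒∣m-n h′ h)
    where
    eq : ∀ a b → a - (a - b) ≡ b
    eq = solve-∀

  module _ f w j (periodic : Periodic f) (lift : Liftable f w j) where

    private K = j ℕ.+ w

    root-shift : ∀ x e → ϖ ^ K ∣ f x → ϖ ^ K ∣ f (x ℕ.+ p ℕ.^ j ℕ.* e)
    root-shift x e h with lift x h
    ... | U , _ , near =
      ∣-cancel-term (∣-cancel-term (∣-weaken (ℕₚ.n≤1+n K) (near e)) (∣m⇒∣m*n (U * + e) ∣-refl)) h

    -- `Liftable` gives nothing at `x` until `x` is known to be a root. So the shift continues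
    -- forward: adding `pʲ e (pʷ - 1)` to `x + pʲ e` gives `x + pʲ⁺ʷ e`, and periodicity leads back
    -- to `x`.
    root-unshift : ∀ x e → ϖ ^ K ∣ f (x ℕ.+ p ℕ.^ j ℕ.* e) → ϖ ^ K ∣ f x
    root-unshift x e h = ∣-cancel-term′ (periodic K x e)
      (subst (λ y → ϖ ^ K ∣ f y) shift (root-shift _ (e ℕ.* ℕ.pred (p ℕ.^ w)) h))
      where
      instance _ = ℕₚ.m^n≢0 p w
      eq : ∀ x a e k → x ℕ.+ a ℕ.* e ℕ.+ a ℕ.* (e ℕ.* k) ≡ x ℕ.+ a ℕ.* (1 ℕ.+ k) ℕ.* e
      eq = ℕSolver.solve-∀
      shift : x ℕ.+ p ℕ.^ j ℕ.* e ℕ.+ p ℕ.^ j ℕ.* (e ℕ.* ℕ.pred (p ℕ.^ w)) ≡ x ℕ.+ p ℕ.^ K ℕ.* e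
      shift = trans (eq x (p ℕ.^ j) e (ℕ.pred (p ℕ.^ w)))
        (cong (λ k → x ℕ.+ k ℕ.* e)
          (trans (cong (p ℕ.^ j ℕ.*_) (ℕₚ.suc-pred (p ℕ.^ w))) (sym (ℕₚ.^-distribˡ-+-* p j w))))

    lift-iff : ∀ x (h : ϖ ^ K ∣ f x) → ∃[ U ] (¬ ϖ ∣ U × (∀ e →
      (ϖ ^ suc K ∣ f (x ℕ.+ p ℕ.^ j ℕ.* e) → ϖ ∣ quotient h + U * + e) ×
      (ϖ ∣ quotient h + U * + e → ϖ ^ suc K ∣ f (x ℕ.+ p ℕ.^ j ℕ.* e))))
    lift-iff x h =
      let U , ¬U , near = lift x h in
      U , ¬U , λ e → lift-∣ K (f (x ℕ.+ p ℕ.^ j ℕ.* e)) (f x) (quotient h) U (+ e)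
        (trans (_∣_.equality h) (ℤₚ.*-comm (quotient h) (ϖ ^ K))) (near e)

    lift-root : ∀ x → ϖ ^ K ∣ f x → ∃[ e ] (ϖ ^ suc K ∣ f (x ℕ.+ p ℕ.^ j ℕ.* e))
    lift-root x h =
      let U , ¬U , iff = lift-iff x h
          e , _ , he = linear-root (quotient h) U ¬U
      in e , proj₂ (iff e) he

    count-lifts : ∀ x → sumTo (λ e → indicator (ϖ ^ suc K ∣? f (x ℕ.+ p ℕ.^ j ℕ.* e))) p ≡
                        indicator (ϖ ^ K ∣? f x)
    count-lifts x = count (ϖ ^ K ∣? f x)
      where
      lifted? = λ e → ϖ ^ suc K ∣? f (x ℕ.+ p ℕ.^ j ℕ.* e)
      count : (d : Dec (ϖ ^ K ∣ f x)) → sumTo (λ e → indicator (lifted? e)) p ≡ indicator d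
      count (no ¬h) = sumTo-zero p λ e _ → indicator-false (lifted? e)
        λ h → ¬h (root-unshift x e (∣-weaken (ℕₚ.n≤1+n K) h))
      count (yes h) =
        let U , ¬U , iff = lift-iff x h
            e , e<p , he = linear-root (quotient h) U ¬U
        in sumTo-unique lifted? p e e<p (proj₂ (iff e) he)
             λ d d<p hd → linear-root-unique (quotient h) U ¬U d<p e<p (proj₁ (iff d) hd) he

    roots-step : roots f (suc j) (suc K) ≡ roots f j K
    roots-step =
      trans (cong (sumTo _) (ℕₚ.*-comm p (p ℕ.^ j)))
      (trans (sumTo-split _ (p ℕ.^ j) p) (sumTo-cong (p ℕ.^ j) λ x _ → count-lifts x))

    roots-multiple : ∀ m → roots f (j ℕ.+ m) K ≡ p ℕ.^ m ℕ.* roots f j K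
    roots-multiple m =
      trans (cong (sumTo _) (ℕₚ.^-distribˡ-+-* p j m))
      (trans (sumTo-split _ (p ℕ.^ j) (p ℕ.^ m))
      (trans (sumTo-cong (p ℕ.^ j) λ x _ →
               trans (sumTo-cong (p ℕ.^ m) λ e _ →
                       indicator-cong {a? = ϖ ^ K ∣? f (x ℕ.+ p ℕ.^ j ℕ.* e)} {ϖ ^ K ∣? f x}
                         (root-unshift x e) (root-shift x e))
                     (sumTo-const _ (p ℕ.^ m)))
             (sumTo-*ˡ (p ℕ.^ m) _ (p ℕ.^ j))))

  -- For `n = j + m` the precision `n + c` equals `j + w` with `w = m + c`. At that precision being
  -- a root depends on `x` modulo `pʲ` only, so each class is counted `pᵐ` times, and unique lifting
  -- makes the number of classes independent of `j`. The excess of precision over modulus is `c`.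
  roots-stable : ∀ {f} J m c → Periodic f → (∀ j → J ≤ j → Liftable f (m ℕ.+ c) j) →
                 StableFrom (J ℕ.+ m) (λ n → roots f n (n ℕ.+ c))
  roots-stable {f} J m c periodic lift n J+m≤n =
    trans (cong (λ n → roots f n (n ℕ.+ c)) n≡)
    (trans (reduce (d ℕ.+ J) (ℕₚ.m≤n+m J d))
    (trans (cong (p ℕ.^ m ℕ.*_) (constant d)) (sym (reduce J ℕₚ.≤-refl))))
    where
    d = n ℕ.∸ (J ℕ.+ m)

    n≡ : n ≡ d ℕ.+ J ℕ.+ m
    n≡ = trans (sym (ℕₚ.m∸n+n≡m J+m≤n)) (sym (ℕₚ.+-assoc d J m))

    reduce : ∀ j → J ≤ j →
      roots f (j ℕ.+ m) (j ℕ.+ m ℕ.+ c) ≡ p ℕ.^ m ℕ.* roots f j (j ℕ.+ (m ℕ.+ c))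
    reduce j J≤j = trans (cong (roots f (j ℕ.+ m)) (ℕₚ.+-assoc j m c))
                         (roots-multiple f (m ℕ.+ c) j periodic (lift j J≤j) m)

    constant : ∀ d → roots f (d ℕ.+ J) (d ℕ.+ J ℕ.+ (m ℕ.+ c)) ≡ roots f J (J ℕ.+ (m ℕ.+ c))
    constant zero    = refl
    constant (suc d) =
      trans (roots-step f (m ℕ.+ c) (d ℕ.+ J) periodic (lift (d ℕ.+ J) (ℕₚ.m≤n+m J d))) (constant d)

  -- Stability of the number of roots of `h`

  ϖ∣gz-p : ∀ {t} → ϖ ∣ t → ϖ ∣ gz t p
  ϖ∣gz-p {t} ϖ∣t with gz-expansion₁ t p
  ... | r , e = subst (ϖ ∣_) (sym e) (∣m∣n⇒∣m+n ∣-refl (∣m⇒∣m*n r ϖ∣t))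

  ϖ^∣gz : ∀ n {t} c → ϖ ∣ t → ϖ ^ n ∣ gz t (p ℕ.^ n ℕ.* c)
  ϖ^∣gz zero {t} c ϖ∣t = ϖ^0∣ (gz t (1 ℕ.* c))
  ϖ^∣gz (suc n) {t} c ϖ∣t = subst (ϖ ^ suc n ∣_)
    (sym (trans (cong (gz t) (ℕₚ.*-assoc p (p ℕ.^ n) c)) (gz-* t p _)))
    (∣-trans (*-monoʳ-∣ ϖ (ϖ^∣gz n c (∣m⇒∣m*n (gz t p) ϖ∣t)))
             (subst₂ _∣_ (ℤₚ.*-comm G ϖ) (ℤₚ.*-comm G (gz t p)) (*-monoʳ-∣ G (ϖ∣gz-p ϖ∣t))))
    where G = gz (t * gz t p) (p ℕ.^ n ℕ.* c)

  h-periodic : ∀ A t → ϖ ∣ t → Periodic (h A t)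
  h-periodic A t ϖ∣t n x y = subst (ϖ ^ n ∣_)
    (sym (combine₁ A (gz-+ t x D)
      (trans (cong (λ z → A * gz t (x ℕ.+ D) - z - h A t x) (ℤₚ.pos-+ x D))
        (eq A t (gz t x) (gz t D) (gz t (x ℕ.+ D)) (+ x) (+ D)))))
    (∣m∣n⇒∣m-n (∣m⇒∣m*n (A + A * (t * gz t x)) (ϖ^∣gz n y ϖ∣t))
               (subst (ϖ ^ n ∣_) (sym (pos-^* n y)) (∣m⇒∣m*n (+ y) ∣-refl)))
    where
    D = p ℕ.^ n ℕ.* y
    eq : ∀ A t g gD gxD x D → A * gxD - (x + D) - (A * g - x) ≡
         gD * (A + A * (t * g)) - D + A * (gxD - (g + gD + t * (g * gD)))
    eq = solve-∀

  periodic-* : ∀ f c → Periodic f → Periodic (λ x → c * f x)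
  periodic-* f c per n x y = subst (ϖ ^ n ∣_) (eq c (f (x ℕ.+ p ℕ.^ n ℕ.* y)) (f x)) (∣n⇒∣m*n c (per n x y))
    where
    eq : ∀ c a b → c * (a - b) ≡ c * a - c * b
    eq = solve-∀

  periodic-+ : ∀ f b → Periodic f → Periodic (λ x → b + f x)
  periodic-+ f b per n x y = subst (ϖ ^ n ∣_) (eq b (f (x ℕ.+ p ℕ.^ n ℕ.* y)) (f x)) (per n x y)
    where
    eq : ∀ b u v → u - v ≡ b + u - (b + v)
    eq = solve-∀

  module _ {P₀} (ϖ∣P₀ : ϖ ∣ P₀) (quadratic : Quadratic P₀) where

    module _ {A t} m α v (P₀∣ϖ^m : P₀ ∣ ϖ ^ m) (A≡ : A ≡ + 1 + ϖ ^ m * α) (t≡ : t ≡ ϖ ^ m * v) where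

      private β = + 2 * α - v

      h-root : ∀ x → ϖ ^ suc m ∣ + 2 * h A t x → ϖ ∣ + x * (β + v * + x)
      h-root x hx with h-quadratic ϖ∣P₀ quadratic α v P₀∣ϖ^m A≡ t≡ x
      ... | s , e = ϖ^-cancel m (subst₂ _∣_ (ℤₚ.*-comm ϖ (ϖ ^ m))
        (combine₁ (+ 1) e (eq (ϖ ^ m) ϖ s _ (+ 2 * h A t x)))
        (∣m∣n⇒∣m-n hx (∣m⇒∣m*n s (∣-refl {ϖ ^ suc m}))))
        where
        eq : ∀ P ϖ s a b → b - ϖ * P * s ≡ P * a + + 1 * (b - (P * a + ϖ * P * s))
        eq = solve-∀

      h-liftable : ¬ ϖ ∣ β → ∀ j → 1 ≤ j → Liftable (λ x → + 2 * h A t x) m j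
      h-liftable ¬β (suc i) _ x hx = U , ¬U , near
        where
        U = β + + 2 * v * + x

        -- U² is congruent to the discriminant β² of y(β + vy).
        ¬U : ¬ ϖ ∣ U
        ¬U hU = [ ¬β , ¬β ]′ (euclid β β (subst (ϖ ∣_) (eq β v (+ x))
          (∣m∣n⇒∣m-n (∣m⇒∣m*n U hU)
            (∣n⇒∣m*n (+ 4 * v) (h-root x (∣-weaken (s≤s (ℕₚ.m≤n+m m i)) hx))))))
          where
          eq : ∀ β v x → (β + + 2 * v * x) * (β + + 2 * v * x) - + 4 * v * (x * (β + v * x)) ≡ β * β
          eq = solve-∀

        near : ∀ e → _
        near e with h-increment ϖ∣P₀ quadratic α v P₀∣ϖ^m A≡ t≡ i x e
        ... | s , inc = divides s
          (trans (cong₂ _-_ inc (cong (_* (U * + e)) split))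
          (trans (eq (ϖ ^ m) (ϖ ^ suc i) (+ e) U ϖ s) (cong (λ z → s * (ϖ * z)) (sym split))))
          where
          split = ℤₚ.^-distribˡ-+-* ϖ (suc i) m
          eq : ∀ P w e U ϖ s → P * (w * e * U) + ϖ * w * P * s - w * P * (U * e) ≡ s * (ϖ * (w * P))
          eq = solve-∀

      h-stable : ¬ ϖ ∣ β → ϖ ∣ t → ∀ m′ c → m ≡ m′ ℕ.+ c →
                 StableFrom (1 ℕ.+ m′) (λ n → roots (λ x → + 2 * h A t x) n (n ℕ.+ c))
      h-stable ¬β ϖ∣t m′ c refl =
        roots-stable 1 m′ c (periodic-* (h A t) (+ 2) (h-periodic A t ϖ∣t)) (h-liftable ¬β)

  roots-cong : ∀ f g k l n → (∀ x → ϖ ^ k ∣ f x → ϖ ^ l ∣ g x) →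
               (∀ x → ϖ ^ l ∣ g x → ϖ ^ k ∣ f x) → roots f n k ≡ roots g n l
  roots-cong f g k l n to from = sumTo-cong (p ℕ.^ n) λ x _ →
    indicator-cong {a? = ϖ ^ k ∣? f x} {ϖ ^ l ∣? g x} (to x) (from x)

  stableFrom-cong : ∀ {f g : ℕ → ℕ} {N} → (∀ n → f n ≡ g n) → StableFrom N f → StableFrom N g
  stableFrom-cong f≡g st n N≤n = trans (sym (f≡g n)) (trans (st n N≤n) (f≡g _))

  roots-2* : ∀ f → ¬ ϖ ∣ + 2 → ∀ n → roots (λ x → + 2 * f x) n (n ℕ.+ 0) ≡ roots f n n
  roots-2* f ¬2 n rewrite ℕₚ.+-identityʳ n =
    roots-cong (λ x → + 2 * f x) f n n n (λ x → cancel-∤ n (f x) ¬2) (λ x → ∣n⇒∣m*n (+ 2))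

  -- From `6 C(p,3) = p(p - 1)(p - 2)` the prime divides `C(p,3)`. As `t²` is a multiple of `ϖ * P`,
  -- the term `C(p,3) t²` is one of `ϖ * ϖ * P`, and so is the tail in `t³`.
  quadratic₅ : ¬ ϖ ∣ + 6 → Quadratic ϖ
  quadratic₅ ¬6 P t (divides π P≡) (divides τ t≡) with gz-expansion t p
  ... | c₂ , c₃ , r , e₂ , e₃ , e with euclid (+ 6) c₃ (subst (ϖ ∣_) (sym e₃)
        (∣m⇒∣m*n (ϖ - + 2) (∣m⇒∣m*n (ϖ - + 1) ∣-refl)))
  ... | inj₁ ∣6 = contradiction ∣6 ¬6
  ... | inj₂ (divides c c₃≡) = y , trans (cong (+ 2 *_) e) (combine₂ t (+ 2 * (t * t)) e₂ c₃≡
          (combine₂ X Y t≡ P≡ (eq P t τ π ϖ c c₂ c₃ r)))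
    where
    y = + 2 * c * τ * τ * π + + 2 * r * τ * τ * τ * π * π
    X = + 2 * c * ϖ * (t + τ * P) + + 2 * r * (t * t + t * τ * P + τ * P * τ * P)
    Y = + 2 * c * ϖ * τ * τ * P + + 2 * r * τ * τ * τ * P * (P + π * ϖ)
    eq : ∀ P t τ π ϖ c c₂ c₃ r → + 2 * (ϖ + c₂ * t + c₃ * (t * t) + r * (t * t * t)) ≡
      + 2 * ϖ + ϖ * (ϖ - + 1) * t
      + ϖ * ϖ * P * (+ 2 * c * τ * τ * π + + 2 * r * τ * τ * τ * π * π)
      + t * (+ 2 * c₂ - ϖ * (ϖ - + 1)) + + 2 * (t * t) * (c₃ - c * ϖ)
      + (+ 2 * c * ϖ * (t + τ * P) + + 2 * r * (t * t + t * τ * P + τ * P * τ * P)) * (t - τ * P)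
      + (+ 2 * c * ϖ * τ * τ * P + + 2 * r * τ * τ * τ * P * (P + π * ϖ)) * (P - π * ϖ)
    eq = solve-∀

  -- From residues of `q` to integer parameters

  mod⇒∣ : ∀ {a b} n → a ≡ b [mod p ℕ.^ n ] → ϖ ^ n ∣ + a - + b
  mod⇒∣ n h = subst (_∣ _) (pos-^ n) (∣-difference h)

  ∣⇒mod : ∀ {a b} n → ϖ ^ n ∣ + a - + b → a ≡ b [mod p ℕ.^ n ]
  ∣⇒mod n h = cong-mod (subst (_∣ _) (sym (pos-^ n)) h)

  T : ℤ[ p ] → ℕ → ℤ
  T q n = + res q n - + 1

  T-diff : ∀ q q′ m n → T q m - T q′ n ≡ + res q m - + res q′ n
  T-diff q q′ m n = eq (+ res q m) (+ res q′ n)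
    where
    eq : ∀ a b → a - + 1 - (b - + 1) ≡ a - b
    eq = solve-∀

  T-coherent : ∀ q {m n} → m ≤ n → ϖ ^ m ∣ T q n - T q m
  T-coherent q {m} {n} m≤n = subst (ϖ ^ m ∣_) (sym (T-diff q q n m))
    (mod⇒∣ m (subst (λ k → res q k ≡ res q m [mod p ℕ.^ m ]) (ℕₚ.m∸n+n≡m m≤n)
      (res-stable q m (n ℕ.∸ m))))

  ∣-diff-trans : ∀ {D} a b c → D ∣ a - b → D ∣ b - c → D ∣ a - c
  ∣-diff-trans {D} a b c d e = subst (D ∣_) (eq a b c) (∣m∣n⇒∣m+n d e)
    where
    eq : ∀ a b c → a - b + (b - c) ≡ a - c
    eq = solve-∀

  ∣-diff-sym : ∀ {D} a b → D ∣ a - b → D ∣ b - a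
  ∣-diff-sym {D} a b d = subst (D ∣_) (eq a b) (∣m⇒∣-m d)
    where
    eq : ∀ a b → - (a - b) ≡ b - a
    eq = solve-∀

  F-cong : ∀ {t t′} n a → ϖ ^ n ∣ t - t′ → ϖ ^ n ∣ F t′ a → ϖ ^ n ∣ F t a
  F-cong {t} {t′} n a d = ∣-cancel-term (subst (ϖ ^ n ∣_) (eq (gz t a) (gz t′ a) (+ a)) (gz-cong a d))
    where
    eq : ∀ g g′ a → g - g′ ≡ g - a - (g′ - a)
    eq = solve-∀

  roots-F-cong : ∀ {t t′} n → ϖ ^ n ∣ t - t′ → roots (F t) n n ≡ roots (F t′) n n
  roots-F-cong {t} {t′} n d = roots-cong (F t) (F t′) n n n (λ a → F-cong n a (∣-diff-sym t t′ d)) (λ a → F-cong n a d)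

  geomℕ-F : ∀ q n a → + geomℕ (res q n) a - + a ≡ F (T q n) a
  geomℕ-F q n a = cong (_- + a) (sym (gz-geomℕ (res q n) a))

  #Fixed≡roots : ∀ q u n → #Fixed q u n ≡ roots (F (T q n)) n n
  #Fixed≡roots q u n = trans (length-filter _ id (p ℕ.^ n)) (sumTo-cong (p ℕ.^ n) λ a _ →
    indicator-cong {a? = ι q u (fromℕ a) ≡? fromℕ a [mod^ n ]} {ϖ ^ n ∣? F (T q n) a}
      (λ h → subst (ϖ ^ n ∣_) (geomℕ-F q n a) (mod⇒∣ n h))
      (λ d → ∣⇒mod n (subst (ϖ ^ n ∣_) (sym (geomℕ-F q n a)) d)))

  -- The function whose roots are counted changes with `n`, since `T q n` does. Stability for the
  -- fixed parameter `T q n` brings the count from level `n` down to level `N`, and there `T q n`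
  -- and `T q N` give equal counts.
  #Fixed-stable : ∀ q u N → (∀ n → N ≤ n → StableFrom N (λ k → roots (F (T q n)) k k)) →
                  AsymptoticallyStable (#Fixed q u)
  #Fixed-stable q u N st = N , λ n N≤n →
    trans (#Fixed≡roots q u n)
    (trans (st n N≤n n N≤n)
    (trans (roots-F-cong N (T-coherent q N≤n)) (sym (#Fixed≡roots q u N))))

  valuation : ∀ n x → ¬ ϖ ^ n ∣ x → ∃[ m ] ∃[ v ] (m < n × x ≡ ϖ ^ m * v × ¬ ϖ ∣ v)
  valuation zero    x ¬d = contradiction (ϖ^0∣ x) ¬d
  valuation (suc n) x ¬d with ϖ ∣? x
  ... | no ¬ϖ = 0 , x , s≤s z≤n , sym (ℤₚ.*-identityˡ x) , ¬ϖ
  ... | yes (divides y refl)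
    with valuation n y (λ d → ¬d (subst (ϖ ^ suc n ∣_) (ℤₚ.*-comm ϖ y) (*-monoʳ-∣ ϖ d)))
  ... | m , v , m<n , e , ¬v = suc m , v , s≤s m<n , eq′ , ¬v
    where
    eq′ : y * ϖ ≡ ϖ ^ suc m * v
    eq′ = trans (ℤₚ.*-comm y ϖ) (trans (cong (ϖ *_) e) (sym (ℤₚ.*-assoc ϖ (ϖ ^ m) v)))

  ϖ∣T : ∀ q → q ∈U 1 → ∀ {n} → 1 ≤ n → ϖ ∣ T q n
  ϖ∣T q u {suc n} _ = ∣-difference (res-∈U {q = q} u n)

  #⇒∤ : ∀ {q q′ n} → ¬ (q ≡ q′ [mod^ n ]) → ∀ {m} → n ≤ m → ¬ ϖ ^ n ∣ T q m - T q′ m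
  #⇒∤ {q} {q′} {n} ¬c {m} n≤m d = ¬c (∣⇒mod n (subst (ϖ ^ n ∣_) (T-diff q q′ n n)
    (∣-diff-trans (T q n) (T q m) (T q′ n) (∣-diff-sym (T q m) (T q n) (T-coherent q n≤m))
      (∣-diff-trans (T q m) (T q′ m) (T q′ n) d (T-coherent q′ n≤m)))))

  T-valuation : ∀ q → q ∈U 1 → ∀ {n₀} → ¬ (q ≡ fromℕ 1 [mod^ n₀ ]) → ∀ {n} → 1 ≤ n → n₀ ≤ n →
                ∃[ m ] ∃[ v ] (suc m < n₀ × T q n ≡ ϖ ^ suc m * v × ¬ ϖ ∣ v)
  T-valuation q u {n₀} ¬c {n} 1≤n n₀≤n
    with valuation n₀ (T q n) (λ d → #⇒∤ {q} {fromℕ 1} ¬c n₀≤n (subst (ϖ ^ n₀ ∣_) (sym (ℤₚ.+-identityʳ _)) d))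
  ... | zero  , v , _ , e , ¬v =
    contradiction (subst (ϖ ∣_) (trans e (ℤₚ.*-identityˡ v)) (ϖ∣T q u 1≤n)) ¬v
  ... | suc m , v , m< , e , ¬v = m , v , m< , e , ¬v

  module _ {P₀} (ϖ∣P₀ : ϖ ∣ P₀) (quadratic : Quadratic P₀) where

    -- `F t` is `h (+ 1) t`, so `α = 0` and `β = - v`: the quadratic is `v x(x - 1)`, with simple
    -- zeros modulo every prime not dividing `v`.
    roots-2F-stable : ∀ {t} m v → P₀ ∣ ϖ ^ suc m → t ≡ ϖ ^ suc m * v → ¬ ϖ ∣ v →
      ∀ m′ c → suc m ≡ m′ ℕ.+ c → StableFrom (1 ℕ.+ m′) (λ n → roots (λ a → + 2 * F t a) n (n ℕ.+ c))
    roots-2F-stable {t} m v P₀∣ t≡ ¬v m′ c m≡ = stableFrom-cong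
      (λ n → roots-cong (λ a → + 2 * h (+ 1) t a) (λ a → + 2 * F t a) (n ℕ.+ c) (n ℕ.+ c) n
        (λ a → subst (ϖ ^ (n ℕ.+ c) ∣_) (F≡ a)) (λ a → subst (ϖ ^ (n ℕ.+ c) ∣_) (sym (F≡ a))))
      (h-stable ϖ∣P₀ quadratic (suc m) (+ 0) v P₀∣ (sym (cong (_+_ (+ 1)) (ℤₚ.*-zeroʳ (ϖ ^ suc m)))) t≡
        (λ d → ¬v (subst (ϖ ∣_) (eq v) (∣m⇒∣-m d)))
        (subst (ϖ ∣_) (sym t≡) (∣m⇒∣m*n v (∣m⇒∣m*n (ϖ ^ m) ∣-refl))) m′ c m≡)
      where
      F≡ : ∀ a → + 2 * h (+ 1) t a ≡ + 2 * F t a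
      F≡ a = cong (λ g → + 2 * (g - + a)) (ℤₚ.*-identityˡ (gz t a))
      eq : ∀ v → - (+ 2 * + 0 - v) ≡ v
      eq = solve-∀

    roots-F-stable : ¬ ϖ ∣ + 2 → ∀ {t} m v → P₀ ∣ ϖ ^ suc m → t ≡ ϖ ^ suc m * v → ¬ ϖ ∣ v →
                     StableFrom (2 ℕ.+ m) (λ n → roots (F t) n n)
    roots-F-stable ¬2 {t} m v P₀∣ t≡ ¬v = stableFrom-cong (roots-2* (F t) ¬2)
      (roots-2F-stable m v P₀∣ t≡ ¬v (suc m) 0 (sym (ℕₚ.+-identityʳ (suc m))))

  stable-if-generic : (∀ m v {t} → t ≡ ϖ ^ suc m * v → ¬ ϖ ∣ v → StableFrom (2 ℕ.+ m) (λ n → roots (F t) n n)) →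
    ∀ q u → q # fromℕ 1 → AsymptoticallyStable (#Fixed q u)
  stable-if-generic generic q u (n₀ , ¬c) = #Fixed-stable q u (1 ℕ.+ n₀) λ n N≤n →
    let m , v , m< , e , ¬v = T-valuation q u ¬c (ℕₚ.≤-trans (s≤s z≤n) N≤n) (ℕₚ.≤-trans (ℕₚ.n≤1+n n₀) N≤n)
    in stableFrom-≤ (ℕₚ.m≤n⇒m≤1+n m<) (generic m v e ¬v)

-- The primes other than 3, and the quadratic approximations at 2 and 3

prime₂ : Prime 2
prime₂ = from-yes (prime? 2)

prime₃ : Prime 3
prime₃ = from-yes (prime? 3)

quadratic₂ : AtPrime.Quadratic 2 prime₂ (+ 2)
quadratic₂ P t _ _ = + 0 , eq P t
  where
  eq : ∀ P t → + 2 * (+ 1 + (+ 1 + t) * (+ 1 + (+ 1 + t) * + 0)) ≡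
               + 2 * + 2 + + 2 * (+ 2 - + 1) * t + + 2 * + 2 * P * + 0
  eq = solve-∀

-- Here `gz t 3 = 3 + 3t + t²`, and `t²` is a multiple of `9P` because `9` divides `P` and `P`
-- divides `t`.
quadratic₃ : AtPrime.Quadratic 3 prime₃ (+ 9)
quadratic₃ P t (divides π P≡) (divides τ t≡) = + 2 * τ * τ * π ,
  combine₂ (+ 2 * (t + τ * P)) (+ 2 * τ * τ * P) t≡ P≡ (eq P t τ π)
  where
  eq : ∀ P t τ π → + 2 * (+ 1 + (+ 1 + t) * (+ 1 + (+ 1 + t) * (+ 1 + (+ 1 + t) * + 0))) ≡
       + 2 * + 3 + + 3 * (+ 3 - + 1) * t + + 3 * + 3 * P * (+ 2 * τ * τ * π)
       + + 2 * (t + τ * P) * (t - τ * P) + + 2 * τ * τ * P * (P - π * + 9)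
  eq = solve-∀

-- `2F` vanishes modulo `2ⁿ⁺¹` exactly when `F` vanishes modulo `2ⁿ`. So the excess precision is 1,
-- taken from the valuation `m + 1` of `t`.
stable₂ : (q : ℤ[ 2 ]) (u : q ∈U 1) → q # fromℕ 1 → AsymptoticallyStable (#Fixed q u)
stable₂ = stable-if-generic λ m v {t} t≡ ¬v → stableFrom-≤ (ℕₚ.n≤1+n (1 ℕ.+ m)) (stableFrom-cong
  (λ n → roots-cong (λ a → + 2 * F t a) (F t) (n ℕ.+ 1) n n
    (λ a d → ϖ^-cancel 1 (subst (λ k → ϖ ^ k ∣ + 2 * F t a) (ℕₚ.+-comm n 1) d))
    (λ a d → subst (λ k → ϖ ^ k ∣ + 2 * F t a) (ℕₚ.+-comm 1 n) (*-monoʳ-∣ (+ 2) d)))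
  (roots-2F-stable ∣-refl quadratic₂ m v (∣m⇒∣m*n (ϖ ^ m) ∣-refl) t≡ ¬v m 1 (ℕₚ.+-comm 1 m)))
  where
  open AtPrime 2 prime₂

stable₅ : ∀ p → Prime p → p ≢ 2 → p ≢ 3 →
          (q : ℤ[ p ]) (u : q ∈U 1) → q # fromℕ 1 → AsymptoticallyStable (#Fixed q u)
stable₅ p pr p≢2 p≢3 = stable-if-generic λ m v t≡ ¬v →
  roots-F-stable ∣-refl (quadratic₅ ¬6) ¬2 m v (∣m⇒∣m*n _ ∣-refl) t≡ ¬v
  where
  open AtPrime p pr
  2≤p : 2 ≤ p
  2≤p = ℕ.nonTrivial⇒n>1 p {{prime⇒nonTrivial pr}}
  ¬2 : ¬ + p ∣ + 2
  ¬2 d = p≢2 (ℕₚ.≤-antisym (ℕ∣.∣⇒≤ (∣⇒∣ᵤ d)) 2≤p)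
  ¬6 : ¬ + p ∣ + 6
  ¬6 d = [ ¬2 , (λ d₃ → p≢3 (ℕₚ.≤-antisym (ℕ∣.∣⇒≤ (∣⇒∣ᵤ d₃)) (ℕₚ.≤∧≢⇒< 2≤p (p≢2 ∘ sym)))) ]′
    (euclid (+ 2) (+ 3) d)

-- The prime 3

open AtPrime 3 prime₃

3∤1 : ¬ + 3 ∣ + 1
3∤1 = from-no (+ 3 ∣? + 1)

3∤2 : ¬ + 3 ∣ + 2
3∤2 = from-no (+ 3 ∣? + 2)

3∣9 : + 3 ∣ + 9
3∣9 = divides (+ 3) refl

-- 3 τ s i is qᵢ - 1 for qᵢ = q^(3ⁱ) and q = 1 + 3s.
τ : ℤ → ℕ → ℤ
τ s zero    = s
τ s (suc i) = + 3 * τ s i * (+ 1 + + 3 * τ s i + + 3 * (τ s i * τ s i))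

-- This is `Aᵢ = qʳ (1 + q + ⋯ + q^(3ⁱ - 1)) / 3ⁱ`. The division is carried out step by step, using
-- `gz (3x) 3 = 3 (1 + 3x + 3x²)`.
slope : ℕ → ℤ → ℕ → ℤ
slope r s zero    = + 1 + + 3 * s * gz (+ 3 * s) r
slope r s (suc i) = slope r s i * (+ 1 + + 3 * τ s i + + 3 * (τ s i * τ s i))

H : ℕ → ℤ → ℕ → ℕ → ℤ
H r s i = h (slope r s i) (+ 3 * τ s i)

H-triple : ∀ r s i y → H r s i (3 ℕ.* y) ≡ + 3 * H r s (suc i) y
H-triple r s i y =
  trans (cong₂ (λ g z → A * g - z) (gz-* t 3 y) (ℤₚ.pos-* 3 y))
  (trans (cong (λ u → A * (gz t 3 * gz u y) - + 3 * + y) (t′≡ (τ s i)))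
         (eq A (τ s i) (gz (+ 3 * τ s (suc i)) y) (+ y)))
  where
  A = slope r s i
  t = + 3 * τ s i
  t′≡ : ∀ x → + 3 * x * (+ 1 + (+ 1 + + 3 * x) * (+ 1 + (+ 1 + + 3 * x) * (+ 1 + (+ 1 + + 3 * x) * + 0))) ≡
              + 3 * (+ 3 * x * (+ 1 + + 3 * x + + 3 * (x * x)))
  t′≡ = solve-∀
  eq : ∀ A x g y →
    A * ((+ 1 + (+ 1 + + 3 * x) * (+ 1 + (+ 1 + + 3 * x) * (+ 1 + (+ 1 + + 3 * x) * + 0))) * g) - + 3 * y ≡
    + 3 * (A * (+ 1 + + 3 * x + + 3 * (x * x)) * g - y)
  eq = solve-∀

F-H : ∀ r s i y → F (+ 3 * s) (r ℕ.+ 3 ℕ.^ i ℕ.* y) ≡ F (+ 3 * s) r + ϖ ^ i * H r s i y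
F-H r s zero y =
  trans (cong (λ z → F t (r ℕ.+ z)) (ℕₚ.+-identityʳ y))
  (trans (cong (λ z → gz t (r ℕ.+ y) - z) (ℤₚ.pos-+ r y))
    (combine₁ (+ 1) (gz-+ t r y) (eq t (gz t r) (gz t y) (gz t (r ℕ.+ y)) (+ r) (+ y))))
  where
  t = + 3 * s
  eq : ∀ t g g′ g″ r y → g″ - (r + y) ≡
       g - r + + 1 * ((+ 1 + t * g) * g′ - y) + + 1 * (g″ - (g + g′ + t * (g * g′)))
  eq = solve-∀
F-H r s (suc i) y =
  trans (cong (λ z → F (+ 3 * s) (r ℕ.+ z)) (shift (3 ℕ.^ i) y))
  (trans (F-H r s i (3 ℕ.* y))
    (combine₁ (ϖ ^ i) (H-triple r s i y)
      (eq (F (+ 3 * s) r) (ϖ ^ i) (H r s i (3 ℕ.* y)) (H r s (suc i) y))))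
  where
  shift : ∀ a y → 3 ℕ.* a ℕ.* y ≡ a ℕ.* (3 ℕ.* y)
  shift = ℕSolver.solve-∀
  eq : ∀ f w a b → f + w * a ≡ f + + 3 * w * b + w * (a - + 3 * b)
  eq = solve-∀

τ-unit : ∀ s i → ∃[ v ] (τ s i ≡ ϖ ^ i * v × + 3 ∣ v - s)
τ-unit s zero = s , sym (ℤₚ.*-identityˡ s) , divides (+ 0) (ℤₚ.+-inverseʳ s)
τ-unit s (suc i) with τ-unit s i
... | v , e , divides k f = v * (+ 1 + + 3 * x + + 3 * (x * x)) ,
  combine₁ (+ 3 * (+ 1 + + 3 * x + + 3 * (x * x))) e (eq x (ϖ ^ i) v) ,
  divides (k + v * (x + x * x)) (combine₁ (+ 1) f (eq′ x v s k))
  where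
  x = τ s i
  eq : ∀ x w v → + 3 * x * (+ 1 + + 3 * x + + 3 * (x * x)) ≡
       + 3 * w * (v * (+ 1 + + 3 * x + + 3 * (x * x))) + + 3 * (+ 1 + + 3 * x + + 3 * (x * x)) * (x - w * v)
  eq = solve-∀
  eq′ : ∀ x v s k → v * (+ 1 + + 3 * x + + 3 * (x * x)) - s ≡ (k + v * (x + x * x)) * + 3 + + 1 * (v - s - k * + 3)
  eq′ = solve-∀

τ-diff : ∀ s s′ i → ∃[ ρ ] (τ s (suc i) - τ s′ (suc i) ≡ + 3 * (s - s′) * ρ)
τ-diff s s′ i = _ , trans (eq (τ s i) (τ s′ i))
  (trans (cong (λ z → + 3 * z * E) (proj₂ (diff i))) (eq′ (s - s′) (proj₁ (diff i)) E))
  where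
  ε : ℤ → ℤ → ℤ
  ε x y = + 1 + + 3 * (x + y) + + 3 * (x * x + x * y + y * y)
  E = ε (τ s i) (τ s′ i)
  eq : ∀ x y → + 3 * x * (+ 1 + + 3 * x + + 3 * (x * x)) - + 3 * y * (+ 1 + + 3 * y + + 3 * (y * y)) ≡
       + 3 * (x - y) * (+ 1 + + 3 * (x + y) + + 3 * (x * x + x * y + y * y))
  eq = solve-∀
  eq′ : ∀ σ ρ e → + 3 * (σ * ρ) * e ≡ + 3 * σ * (ρ * e)
  eq′ = solve-∀
  eq″ : ∀ σ ρ e → + 3 * (σ * ρ) * e ≡ σ * (+ 3 * ρ * e)
  eq″ = solve-∀
  diff : ∀ i → ∃[ ρ ] (τ s i - τ s′ i ≡ (s - s′) * ρ)
  diff zero    = + 1 , sym (ℤₚ.*-identityʳ _)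
  diff (suc i) = _ , trans (eq (τ s i) (τ s′ i))
    (trans (cong (λ z → + 3 * z * ε (τ s i) (τ s′ i)) (proj₂ (diff i)))
      (eq″ (s - s′) (proj₁ (diff i)) (ε (τ s i) (τ s′ i))))

-- Up to a unit the slopes differ by 3s - 3s′, so the slope determines q.
SlopeDiff : ℕ → ℤ → ℤ → ℕ → Set
SlopeDiff r s s′ i = ∃[ ω ] (¬ + 3 ∣ ω × slope r s i - slope r s′ i ≡ + 3 * (s - s′) * ω)

-- A step multiplies the slope by `1 + 3x + 3x²`, which is 1 modulo 3. From stage 1 on, the two
-- values of `x` differ by a multiple of `3(s - s′)`, so `ω` changes by a multiple of 3. At stage 0
-- they differ by `s - s′` itself, which is why `base` concerns stage 1.
slope-diff : ∀ r s s′ → SlopeDiff r s s′ 1 → ∀ i → SlopeDiff r s s′ (suc i)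
slope-diff r s s′ base zero = base
slope-diff r s s′ base (suc i) with slope-diff r s s′ base i | τ-diff s s′ i
... | ω , ¬ω , e | ρ , f =
  ω + + 3 * κ ,
  (λ 3∣ω′ → ¬ω (subst (+ 3 ∣_) (eq′ ω κ) (∣m∣n⇒∣m-n 3∣ω′ (∣m⇒∣m*n κ (∣-refl {+ 3}))))) ,
  combine₂ (+ 1 + + 3 * x + + 3 * (x * x)) (A′ * + 3 * (+ 1 + x + y)) e f
    (eq (slope r s (suc i)) A′ x y ω ρ (s - s′))
  where
  x = τ s (suc i)
  y = τ s′ (suc i)
  A′ = slope r s′ (suc i)
  κ = ω * (x + x * x) + A′ * ρ * (+ 1 + x + y)
  eq′ : ∀ ω κ → ω + + 3 * κ - + 3 * κ ≡ ω
  eq′ = solve-∀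
  eq : ∀ A A′ x y ω ρ σ → A * (+ 1 + + 3 * x + + 3 * (x * x)) - A′ * (+ 1 + + 3 * y + + 3 * (y * y)) ≡
       + 3 * σ * (ω + + 3 * (ω * (x + x * x) + A′ * ρ * (+ 1 + x + y)))
       + (+ 1 + + 3 * x + + 3 * (x * x)) * (A - A′ - + 3 * σ * ω)
       + A′ * + 3 * (+ 1 + x + y) * (x - y - + 3 * σ * ρ)
  eq = solve-∀

Unstopped : ℕ → ℤ → ℕ → Set
Unstopped r s i = ϖ ^ suc i ∣ slope r s i - + 1

unstopped-cong : ∀ {r s s′ n} → SlopeDiff r s s′ 1 → ϖ ^ n ∣ + 3 * (s - s′) →
  ∀ i → suc (suc i) ≤ n → Unstopped r s (suc i) → Unstopped r s′ (suc i)
unstopped-cong {r} {s} {s′} base n∣ i i≤n u with slope-diff r s s′ base i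
... | ω , _ , e = subst (ϖ ^ suc (suc i) ∣_) (eq (slope r s (suc i)) (slope r s′ (suc i)))
  (∣m∣n⇒∣m-n u (subst (ϖ ^ suc (suc i) ∣_) (sym e) (∣m⇒∣m*n ω (∣-weaken i≤n n∣))))
  where
  eq : ∀ a b → a - + 1 - (a - b) ≡ b - + 1
  eq = solve-∀

unstopped-unique : ∀ {r s s′} → SlopeDiff r s s′ 1 → ∀ i →
  Unstopped r s (suc i) → Unstopped r s′ (suc i) → ϖ ^ suc (suc i) ∣ + 3 * (s - s′)
unstopped-unique {r} {s} {s′} base i u u′ with slope-diff r s s′ base i
... | ω , ¬ω , e = cancel-∤ (suc (suc i)) (+ 3 * (s - s′)) ¬ω
  (subst (ϖ ^ suc (suc i) ∣_) (trans (eq (slope r s (suc i)) (slope r s′ (suc i)))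
    (trans e (ℤₚ.*-comm (+ 3 * (s - s′)) ω))) (∣m∣n⇒∣m-n u u′))
  where
  eq : ∀ a b → a - + 1 - (b - + 1) ≡ a - b
  eq = solve-∀

-- One stage of the descent

module Stage (r : ℕ) (s : ℤ) (3∤s : ¬ + 3 ∣ s) (k : ℕ) where

  -- Stages start at 1, so that `3ⁱ⁺¹` is divisible by 9, as `quadratic₃` requires.
  i = suc k
  A = slope r s i
  t = + 3 * τ s i

  v : ℤ
  v = proj₁ (τ-unit s i)

  t≡ : t ≡ ϖ ^ suc i * v
  t≡ = trans (cong (+ 3 *_) (proj₁ (proj₂ (τ-unit s i)))) (sym (ℤₚ.*-assoc (+ 3) (ϖ ^ i) v))

  3∤v : ¬ + 3 ∣ v
  3∤v 3∣v = 3∤s (∣-cancel-term′ (proj₂ (proj₂ (τ-unit s i))) 3∣v)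

  3∣t : + 3 ∣ t
  3∣t = ∣m⇒∣m*n (τ s i) (∣-refl {+ 3})

  9∣3^ : + 9 ∣ ϖ ^ suc i
  9∣3^ = ϖ^∣ϖ^ {2} {suc i} (s≤s (s≤s z≤n))

  module _ (u : Unstopped r s i) where

    α : ℤ
    α = quotient u

    β : ℤ
    β = + 2 * α - v

    A≡ : A ≡ + 1 + ϖ ^ suc i * α
    A≡ = combine₁ (+ 1) (_∣_.equality u) (eq A α (ϖ ^ suc i))
      where
      eq : ∀ A α P → A ≡ + 1 + P * α + + 1 * (A - + 1 - α * P)
      eq = solve-∀

    -- Modulo 3, `α + v` is the negative of `β = 2α - v`. So the digit that decides whether the next
    -- slope is unstopped is the one that decides whether the quadratic has a double zero.
    slope-suc : ∃[ x ] (slope r s (suc i) - + 1 ≡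
                        ϖ ^ suc i * (α + v) + ϖ ^ suc (suc i) * x)
    slope-suc = _ , trans (cong₂ (λ A x → A * (+ 1 + + 3 * x + + 3 * (x * x)) - + 1) A≡
                            (proj₁ (proj₂ (τ-unit s i))))
                          (eq (ϖ ^ k) α v)
      where
      eq : ∀ w α v → (+ 1 + + 3 * (+ 3 * w) * α) *
        (+ 1 + + 3 * (+ 3 * w * v) + + 3 * (+ 3 * w * v * (+ 3 * w * v))) - + 1 ≡
        + 3 * (+ 3 * w) * (α + v) + + 3 * (+ 3 * (+ 3 * w)) *
          (+ 3 * w * α * v + w * v * v * (+ 1 + + 9 * w * α))
      eq = solve-∀

    3∣β⇒unstopped : + 3 ∣ β → Unstopped r s (suc i)
    3∣β⇒unstopped 3∣β = subst (ϖ ^ suc (suc i) ∣_) (sym (proj₂ slope-suc))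
      (∣m∣n⇒∣m+n (ϖ∣⇒ϖ^suc∣ (suc i) (α + v) 3∣α+v) (ϖ^∣ϖ^* (suc (suc i)) (proj₁ slope-suc)))
      where
      eq : ∀ α v → + 3 * α - (+ 2 * α - v) ≡ α + v
      eq = solve-∀
      3∣α+v : + 3 ∣ α + v
      3∣α+v = subst (+ 3 ∣_) (eq α v) (∣m∣n⇒∣m-n (∣m⇒∣m*n α (∣-refl {+ 3})) 3∣β)

    unstopped⇒3∣β : Unstopped r s (suc i) → + 3 ∣ β
    unstopped⇒3∣β u′ = subst (+ 3 ∣_) (eq′ α v)
      (∣m∣n⇒∣m-n (∣n⇒∣m*n (+ 2) 3∣α+v) (∣m⇒∣m*n v (∣-refl {+ 3})))
      where
      eq : ∀ a b → a + b - b ≡ a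
      eq = solve-∀
      eq′ : ∀ α v → + 2 * (α + v) - + 3 * v ≡ + 2 * α - v
      eq′ = solve-∀
      x = proj₁ slope-suc
      3∣α+v : + 3 ∣ α + v
      3∣α+v = ϖ^suc∣⇒ϖ∣ (suc i) (α + v)
        (subst (ϖ ^ suc (suc i) ∣_) (eq (ϖ ^ suc i * (α + v)) (ϖ ^ suc (suc i) * x))
          (∣m∣n⇒∣m-n (subst (ϖ ^ suc (suc i) ∣_) (proj₂ slope-suc) u′) (ϖ^∣ϖ^* (suc (suc i)) x)))

    root-condition : ∀ x → ϖ ^ suc (suc i) ∣ H r s i x → + 3 ∣ + x * (β + v * + x)
    root-condition x hx = h-root 3∣9 quadratic₃ (suc i) α v 9∣3^ A≡ t≡ x (∣n⇒∣m*n (+ 2) hx)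

    stopped-stable : ¬ + 3 ∣ β → StableFrom (2 ℕ.+ i) (λ n → roots (H r s i) n n)
    stopped-stable ¬β = stableFrom-cong (roots-2* (H r s i) 3∤2)
      (h-stable 3∣9 quadratic₃ (suc i) α v 9∣3^ A≡ t≡ ¬β 3∣t (suc i) 0 (sym (ℕₚ.+-identityʳ (suc i))))

    -- With `3 ∣ β` the quadratic is `v x²` modulo 3, so no `x` prime to 3 is a root once the
    -- precision reaches `i + 2`. On multiples of 3, `H-triple` removes one digit from modulus and
    -- precision alike.
    descend : + 3 ∣ β → ∀ n → suc i ≤ n →
              roots (H r s i) (suc n) (suc n) ≡ roots (H r s (suc i)) n n
    descend 3∣β n i<n =
      trans (sumTo-split (λ x → indicator (ϖ ^ suc n ∣? H r s i x)) 3 (3 ℕ.^ n))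
      (trans (cong₂ ℕ._+_
        (roots-cong (λ y → H r s i (3 ℕ.* y)) (H r s (suc i)) (suc n) n n
          (λ y d → ϖ^-cancel 1 (subst (ϖ ^ suc n ∣_) (H-triple r s i y) d))
          (λ y d → subst (ϖ ^ suc n ∣_) (sym (H-triple r s i y)) (*-monoʳ-∣ (+ 3) d)))
        (cong₂ ℕ._+_ (none 1 3∤1)
                     (cong (ℕ._+ 0) (none 2 3∤2))))
      (ℕₚ.+-identityʳ _))
      where
      none : ∀ c → ¬ + 3 ∣ + c →
        sumTo (λ y → indicator (ϖ ^ suc n ∣? H r s i (c ℕ.+ 3 ℕ.* y))) (3 ℕ.^ n) ≡ 0
      none c 3∤c = sumTo-zero (3 ℕ.^ n) λ y _ →
        indicator-false (ϖ ^ suc n ∣? H r s i (c ℕ.+ 3 ℕ.* y)) (no-root y)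
        where
        eq : ∀ b v x → x * (b + v * x) - x * b ≡ v * (x * x)
        eq = solve-∀
        eq′ : ∀ c y → c + + 3 * y - + 3 * y ≡ c
        eq′ = solve-∀
        no-root : ∀ y → ¬ ϖ ^ suc n ∣ H r s i (c ℕ.+ 3 ℕ.* y)
        no-root y d = [ 3∤v , [ 3∤x , 3∤x ]′ ∘ euclid (+ x) (+ x) ]′ (euclid v (+ x * + x)
          (subst (+ 3 ∣_) (eq β v (+ x))
            (∣m∣n⇒∣m-n (root-condition x (∣-weaken (s≤s i<n) d)) (∣n⇒∣m*n (+ x) 3∣β))))
          where
          x = c ℕ.+ 3 ℕ.* y
          3∤x : ¬ + 3 ∣ + x
          3∤x 3∣x = 3∤c (subst (+ 3 ∣_)
            (trans (cong (_- + 3 * + y) (trans (ℤₚ.pos-+ c (3 ℕ.* y)) (cong (_+_ (+ c)) (ℤₚ.pos-* 3 y))))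
                   (eq′ (+ c) (+ y)))
            (∣m∣n⇒∣m-n 3∣x (∣m⇒∣m*n (+ y) (∣-refl {+ 3}))))

-- `f` bounds the number of stages still to pass. Each adds 2 to the bound: one for the digit lost
-- in `descend`, one for the larger valuation at the next stage.
stage-stable : ∀ r s → ¬ + 3 ∣ s → ∀ f k → Unstopped r s (suc k) → ¬ Unstopped r s (f ℕ.+ suc k) →
  StableFrom (3 ℕ.+ k ℕ.+ (f ℕ.+ f)) (λ n → roots (H r s (suc k)) n n)
stage-stable r s 3∤s zero    k u ¬u = contradiction u ¬u
stage-stable r s 3∤s (suc f) k u ¬u with + 3 ∣? Stage.β r s 3∤s k u
... | no ¬β = stableFrom-≤ (ℕₚ.m≤m+n (3 ℕ.+ k) _) (Stage.stopped-stable r s 3∤s k u ¬β)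
... | yes 3∣β = subst (λ M → StableFrom M (λ n → roots (H r s (suc k)) n n)) (sym (N≡ k f)) shift
  where
  open Stage r s 3∤s k
  N = 3 ℕ.+ suc k ℕ.+ (f ℕ.+ f)
  rec : StableFrom N (λ n → roots (H r s (suc (suc k))) n n)
  rec = stage-stable r s 3∤s f (suc k) (3∣β⇒unstopped u 3∣β)
    (subst (λ j → ¬ Unstopped r s j) (sym (ℕₚ.+-suc f (suc k))) ¬u)
  bound : 2 ℕ.+ k ≤ N
  bound = ℕₚ.≤-trans (s≤s (s≤s (ℕₚ.n≤1+n k))) (ℕₚ.≤-trans (ℕₚ.n≤1+n (3 ℕ.+ k)) (ℕₚ.m≤m+n (4 ℕ.+ k) (f ℕ.+ f)))
  N≡ : ∀ k f → 3 ℕ.+ k ℕ.+ (1 ℕ.+ f ℕ.+ (1 ℕ.+ f)) ≡ 1 ℕ.+ (3 ℕ.+ (1 ℕ.+ k) ℕ.+ (f ℕ.+ f))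
  N≡ = ℕSolver.solve-∀
  shift : StableFrom (suc N) (λ n → roots (H r s (suc k)) n n)
  shift (suc n) (s≤s N≤n) =
    trans (descend u 3∣β n (ℕₚ.≤-trans bound N≤n))
    (trans (rec n N≤n) (sym (descend u 3∣β N bound)))

-- Fixed points in one residue class modulo 3

-- When `A - 1` is divisible by 3 but not by 9, the linear term dominates: over a step `d = 3ʲe` the
-- function changes by `9γd` modulo `27 · 3ʲ`. So the derivative has valuation 2 everywhere, not
-- just at roots.
affine-liftable : ∀ b γ v j → ¬ + 3 ∣ γ → Liftable (λ x → b + + 3 * h (+ 1 + + 3 * γ) (+ 9 * v) x) 2 j
affine-liftable b γ v j 3∤γ x _ = γ , 3∤γ , near
  where
  A = + 1 + + 3 * γ
  t = + 9 * v
  W = ϖ ^ j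
  near : ∀ e → ϖ ^ suc (j ℕ.+ 2) ∣
    b + + 3 * h A t (x ℕ.+ 3 ℕ.^ j ℕ.* e) - (b + + 3 * h A t x) - ϖ ^ (j ℕ.+ 2) * (γ * + e)
  near e with gz-quadratic 3∣9 quadratic₃ j e (+ 9) t ∣-refl (∣m⇒∣m*n v ∣-refl)
  ... | s , e₂ = cancel-∤ (suc (j ℕ.+ 2)) _ 3∤2 (divides R
    (trans (cong₂ (λ z w → + 2 * (b + + 3 * (A * gz t (x ℕ.+ D) - z) - (b + + 3 * h A t x) - w * (γ * + e)))
             (trans (ℤₚ.pos-+ x D) (cong (_+_ (+ x)) (pos-^* j e))) split)
    (trans (combine₂ (+ 6 * A) (+ 3 * A * (+ 1 + t * gz t x)) (gz-+ t x D) e₂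
             (eq b γ v (+ x) W (+ e) s (gz t x) (gz t D) (gz t (x ℕ.+ D))))
           (cong (λ w → R * (+ 3 * w)) (sym split)))))
    where
    D = 3 ℕ.^ j ℕ.* e
    R = A * (v * gz t x * (+ 2 * + e)) + A * (+ 1 + + 9 * (v * gz t x)) * (v * + e * (W * + e - + 1) + + 3 * s)
    split : ϖ ^ (j ℕ.+ 2) ≡ W * + 9
    split = ℤₚ.^-distribˡ-+-* (+ 3) j 2
    eq : ∀ b γ v x W e s g gD gxD →
      + 2 * (b + + 3 * ((+ 1 + + 3 * γ) * gxD - (x + W * e)) - (b + + 3 * ((+ 1 + + 3 * γ) * g - x)) - W * + 9 * (γ * e)) ≡
      ((+ 1 + + 3 * γ) * (v * g * (+ 2 * e)) + (+ 1 + + 3 * γ) * (+ 1 + + 9 * (v * g)) *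
        (v * e * (W * e - + 1) + + 3 * s)) * (+ 3 * (W * + 9))
      + + 6 * (+ 1 + + 3 * γ) * (gxD - (g + gD + + 9 * v * (g * gD)))
      + + 3 * (+ 1 + + 3 * γ) * (+ 1 + + 9 * v * g) *
        (+ 2 * gD - (+ 2 * (W * e) + + 9 * v * (W * e * (W * e - + 1)) + + 3 * W * + 9 * s))
    eq = solve-∀

-- The fixed points congruent to r modulo 3 are counted modulo 3ⁿ⁺¹, not 3ⁿ.
region : ℤ → ℕ → ℕ → ℕ
region t r n = roots (λ y → F t (r ℕ.+ 3 ℕ.* y)) n (suc n)

fixed-split : ∀ t n → roots (F t) (suc n) (suc n) ≡ sumTo (λ r → region t r n) 3
fixed-split t n = sumTo-split (λ x → indicator (ϖ ^ suc n ∣? F t x)) 3 (3 ℕ.^ n)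

-- The constant `b` is kept because `r = 2` is to be covered, where `F` need not vanish. The
-- valuation 2 splits as `1 + 1`, one unit being the excess precision of `region`.
stopped-region : ∀ r s → ¬ Unstopped r s 1 → StableFrom 1 (region (+ 3 * s) r)
stopped-region r s ¬u = stableFrom-cong unfold
  (roots-stable {f} 0 1 1 (periodic-+ (λ x → + 3 * h A t x) b (periodic-* (h A t) (+ 3) (h-periodic A t (∣m⇒∣m*n v 3∣9))))
    (λ j _ → affine-liftable b γ v j 3∤γ))
  where
  g = gz (+ 3 * s) r
  γ = s * g + (s + s * s) * (+ 1 + + 3 * s * g)
  v = s * (+ 1 + + 3 * s + + 3 * (s * s))
  b = F (+ 3 * s) r
  A = + 1 + + 3 * γ
  t = + 9 * v
  f = λ x → b + + 3 * h A t x
  A≡ : slope r s 1 ≡ A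
  A≡ = eq s g
    where
    eq : ∀ s g → (+ 1 + + 3 * s * g) * (+ 1 + + 3 * s + + 3 * (s * s)) ≡
         + 1 + + 3 * (s * g + (s + s * s) * (+ 1 + + 3 * s * g))
    eq = solve-∀
  t≡ : + 3 * τ s 1 ≡ t
  t≡ = eq s
    where
    eq : ∀ s → + 3 * (+ 3 * s * (+ 1 + + 3 * s + + 3 * (s * s))) ≡ + 9 * (s * (+ 1 + + 3 * s + + 3 * (s * s)))
    eq = solve-∀
  3∤γ : ¬ + 3 ∣ γ
  3∤γ 3∣γ = ¬u (subst (λ A → + 9 ∣ A - + 1) (sym A≡) (subst (+ 9 ∣_) (eq γ) (*-monoʳ-∣ (+ 3) 3∣γ)))
    where
    eq : ∀ γ → + 3 * γ ≡ + 1 + + 3 * γ - + 1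
    eq = solve-∀
  F≡f : ∀ y → F (+ 3 * s) (r ℕ.+ 3 ℕ.* y) ≡ f y
  F≡f y = trans (F-H r s 1 y) (cong₂ (λ A t → b + + 3 * h A t y) A≡ t≡)
  unfold : ∀ n → roots f n (n ℕ.+ 1) ≡ region (+ 3 * s) r n
  unfold n rewrite ℕₚ.+-comm n 1 = roots-cong f (λ y → F (+ 3 * s) (r ℕ.+ 3 ℕ.* y)) (suc n) (suc n) n
    (λ y → subst (ϖ ^ suc n ∣_) (sym (F≡f y))) (λ y → subst (ϖ ^ suc n ∣_) (F≡f y))

F-H₀ : ∀ r s i y → F (+ 3 * s) r ≡ + 0 → F (+ 3 * s) (r ℕ.+ 3 ℕ.^ i ℕ.* y) ≡ ϖ ^ i * H r s i y
F-H₀ r s i y F0 = trans (F-H r s i y)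
  (trans (cong (_+ ϖ ^ i * H r s i y) F0) (ℤₚ.+-identityˡ _))

unstopped-region : ∀ r s → ¬ + 3 ∣ s → F (+ 3 * s) r ≡ + 0 → ∀ f → Unstopped r s 1 →
  ¬ Unstopped r s (f ℕ.+ 1) → StableFrom (3 ℕ.+ (f ℕ.+ f)) (region (+ 3 * s) r)
unstopped-region r s 3∤s F0 f u ¬u = stableFrom-cong
  (λ n → roots-cong (H r s 1) (λ y → F (+ 3 * s) (r ℕ.+ 3 ℕ.* y)) n (suc n) n
    (λ y d → subst (ϖ ^ suc n ∣_) (sym (F-H₀ r s 1 y F0)) (*-monoʳ-∣ (+ 3) d))
    (λ y d → ϖ^-cancel 1 (subst (ϖ ^ suc n ∣_) (F-H₀ r s 1 y F0) d)))
  (stage-stable r s 3∤s f 0 u ¬u)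

-- The critical classes modulo 9

-- The residues r for which ι_q can have a double fixed point congruent to r
-- modulo 3, which happens only for q ≡ 1 + 3c modulo 9.
record Critical (r : ℕ) (c : ℤ) : Set where
  field
    r≡0⊎1       : r ≡ 0 ⊎ r ≡ 1
    3∤c         : ¬ + 3 ∣ c
    unstopped⇒c : ∀ s → ¬ + 3 ∣ s → Unstopped r s 1 → + 3 ∣ s - c
    c⇒unstopped : ∀ s → + 3 ∣ s - c → Unstopped r s 1
    c⇒slopeDiff : ∀ s s′ → + 3 ∣ s - c → + 3 ∣ s′ - c → SlopeDiff r s s′ 1

  F-zero : ∀ t → F t r ≡ + 0
  F-zero t with r≡0⊎1
  ... | inj₁ refl = refl
  ... | inj₂ refl = eq t
    where
    eq : ∀ t → + 1 + (+ 1 + t) * + 0 - + 1 ≡ + 0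
    eq = solve-∀

  c⇒3∤s : ∀ {s} → + 3 ∣ s - c → ¬ + 3 ∣ s
  c⇒3∤s h 3∣s = 3∤c (∣-cancel-term′ h 3∣s)

-- For `r = 0`, `A₁ - 1 = 3s(1 + s)`, so a unit `s` must be 2 modulo 3, that is `q ≡ 7` modulo 9.
-- Then `ω = 1 + s + s′` is 5 modulo 3.
critical₀ : Critical 0 (+ 2)
critical₀ = record
  { r≡0⊎1 = inj₁ refl
  ; 3∤c = 3∤2
  ; unstopped⇒c = λ s 3∤s u → [ (λ 3∣s → contradiction 3∣s 3∤s) ,
      (λ d → subst (+ 3 ∣_) (eq₂ s) (∣m∣n⇒∣m-n d (∣-refl {+ 3}))) ]′
      (euclid s (+ 1 + s) (ϖ^-cancel 1 (subst (+ 9 ∣_) (eq₁ s) u)))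
  ; c⇒unstopped = λ s d → subst (+ 9 ∣_) (sym (eq₁ s)) (*-monoʳ-∣ (+ 3)
      (∣n⇒∣m*n s (subst (+ 3 ∣_) (eq₃ s) (∣m∣n⇒∣m+n d (∣-refl {+ 3})))))
  ; c⇒slopeDiff = λ s s′ d d′ → + 1 + s + s′ ,
      (λ dω → from-no (+ 3 ∣? + 5) (subst (+ 3 ∣_) (eq₄ s s′) (∣m∣n⇒∣m-n (∣m∣n⇒∣m-n dω d) d′))) ,
      eq₅ s s′
  }
  where
  eq₁ : ∀ s → (+ 1 + + 3 * s * + 0) * (+ 1 + + 3 * s + + 3 * (s * s)) - + 1 ≡ + 3 * (s * (+ 1 + s))
  eq₁ = solve-∀
  eq₂ : ∀ s → + 1 + s - + 3 ≡ s - + 2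
  eq₂ = solve-∀
  eq₃ : ∀ s → s - + 2 + + 3 ≡ + 1 + s
  eq₃ = solve-∀
  eq₄ : ∀ s s′ → + 1 + s + s′ - (s - + 2) - (s′ - + 2) ≡ + 5
  eq₄ = solve-∀
  eq₅ : ∀ s s′ → (+ 1 + + 3 * s * + 0) * (+ 1 + + 3 * s + + 3 * (s * s)) -
        (+ 1 + + 3 * s′ * + 0) * (+ 1 + + 3 * s′ + + 3 * (s′ * s′)) ≡ + 3 * (s - s′) * (+ 1 + s + s′)
  eq₅ = solve-∀

-- For `r = 1`, `A₁ - 1 = 3s(2 + 4s + 3s²)`, so a unit `s` must be 1 modulo 3, that is `q ≡ 4`
-- modulo 9. Then `ω` is `2 + 4 + 4 = 10` modulo 3.
critical₁ : Critical 1 (+ 1)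
critical₁ = record
  { r≡0⊎1 = inj₂ refl
  ; 3∤c = 3∤1
  ; unstopped⇒c = λ s 3∤s u → [ (λ 3∣s → contradiction 3∣s 3∤s) ,
      (λ d → subst (+ 3 ∣_) (eq₂ s) (∣m∣n⇒∣m-n d (∣m⇒∣m*n (+ 1 + s + s * s) (∣-refl {+ 3})))) ]′
      (euclid s (+ 2 + + 4 * s + + 3 * (s * s)) (ϖ^-cancel 1 (subst (+ 9 ∣_) (eq₁ s) u)))
  ; c⇒unstopped = λ s d → subst (+ 9 ∣_) (sym (eq₁ s)) (*-monoʳ-∣ (+ 3)
      (∣n⇒∣m*n s (subst (+ 3 ∣_) (eq₃ s) (∣m∣n⇒∣m+n d (∣m⇒∣m*n (+ 1 + s + s * s) (∣-refl {+ 3}))))))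
  ; c⇒slopeDiff = λ s s′ d d′ → + 2 + + 4 * (s + s′) + + 3 * (s * s + s * s′ + s′ * s′) ,
      (λ dω → from-no (+ 3 ∣? + 10) (subst (+ 3 ∣_) (eq₄ s s′) (∣m∣n⇒∣m-n (∣m∣n⇒∣m-n (∣m∣n⇒∣m-n dω
        (∣m⇒∣m*n (s * s + s * s′ + s′ * s′) (∣-refl {+ 3}))) (∣n⇒∣m*n (+ 4) d)) (∣n⇒∣m*n (+ 4) d′)))) ,
      eq₅ s s′
  }
  where
  eq₁ : ∀ s → (+ 1 + + 3 * s * (+ 1 + (+ 1 + + 3 * s) * + 0)) * (+ 1 + + 3 * s + + 3 * (s * s)) - + 1 ≡
        + 3 * (s * (+ 2 + + 4 * s + + 3 * (s * s)))
  eq₁ = solve-∀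
  eq₂ : ∀ s → + 2 + + 4 * s + + 3 * (s * s) - + 3 * (+ 1 + s + s * s) ≡ s - + 1
  eq₂ = solve-∀
  eq₃ : ∀ s → s - + 1 + + 3 * (+ 1 + s + s * s) ≡ + 2 + + 4 * s + + 3 * (s * s)
  eq₃ = solve-∀
  eq₄ : ∀ s s′ → + 2 + + 4 * (s + s′) + + 3 * (s * s + s * s′ + s′ * s′)
        - + 3 * (s * s + s * s′ + s′ * s′) - + 4 * (s - + 1) - + 4 * (s′ - + 1) ≡ + 10
  eq₄ = solve-∀
  eq₅ : ∀ s s′ → (+ 1 + + 3 * s * (+ 1 + (+ 1 + + 3 * s) * + 0)) * (+ 1 + + 3 * s + + 3 * (s * s)) -
        (+ 1 + + 3 * s′ * (+ 1 + (+ 1 + + 3 * s′) * + 0)) * (+ 1 + + 3 * s′ + + 3 * (s′ * s′)) ≡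
        + 3 * (s - s′) * (+ 2 + + 4 * (s + s′) + + 3 * (s * s + s * s′ + s′ * s′))
  eq₅ = solve-∀

-- For `r = 2`, `(A₁ - 1) / 3` is `s²` modulo 3, hence a unit.
¬unstopped₂ : ∀ s → ¬ + 3 ∣ s → ¬ Unstopped 2 s 1
¬unstopped₂ s 3∤s u = [ 3∤s , 3∤s ]′ (euclid s s (subst (+ 3 ∣_) (eq′ s)
  (∣m∣n⇒∣m-n (ϖ^-cancel 1 (subst (+ 9 ∣_) (eq s) u))
    (∣m⇒∣m*n (s + + 3 * (s * s) + + 5 * (s * s * s) + + 3 * (s * s * s * s)) (∣-refl {+ 3})))))
  where
  eq : ∀ s → (+ 1 + + 3 * s * (+ 1 + (+ 1 + + 3 * s) * (+ 1 + (+ 1 + + 3 * s) * + 0))) *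
       (+ 1 + + 3 * s + + 3 * (s * s)) - + 1 ≡
       + 3 * (+ 3 * s + + 10 * (s * s) + + 15 * (s * s * s) + + 9 * (s * s * s * s))
  eq = solve-∀
  eq′ : ∀ s → + 3 * s + + 10 * (s * s) + + 15 * (s * s * s) + + 9 * (s * s * s * s)
        - + 3 * (s + + 3 * (s * s) + + 5 * (s * s * s) + + 3 * (s * s * s * s)) ≡ s * s
  eq′ = solve-∀

fixed-stable₃ : ∀ s → ¬ + 3 ∣ s → ∀ f →
  (Unstopped 0 s 1 → ¬ Unstopped 0 s (f ℕ.+ 1)) → (Unstopped 1 s 1 → ¬ Unstopped 1 s (f ℕ.+ 1)) →
  StableFrom (4 ℕ.+ (f ℕ.+ f)) (λ n → roots (F (+ 3 * s)) n n)
fixed-stable₃ s 3∤s f ¬u₀ ¬u₁ (suc n) (s≤s N≤n) =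
  trans (fixed-split t n) (trans (sumTo-cong 3 λ r r<3 → stable r r<3 n N≤n) (sym (fixed-split t N)))
  where
  t = + 3 * s
  N = 3 ℕ.+ (f ℕ.+ f)
  1≤N : 1 ≤ N
  1≤N = s≤s z≤n
  decide : ∀ r → F t r ≡ + 0 → (Unstopped r s 1 → ¬ Unstopped r s (f ℕ.+ 1)) → StableFrom N (region t r)
  decide r F0 ¬u with + 9 ∣? (slope r s 1 - + 1)
  ... | no ¬u₁  = stableFrom-≤ 1≤N (stopped-region r s ¬u₁)
  ... | yes u₁  = unstopped-region r s 3∤s F0 f u₁ (¬u u₁)
  stable : ∀ r → r < 3 → StableFrom N (region t r)
  stable 0 _ = decide 0 (Critical.F-zero critical₀ t) ¬u₀
  stable 1 _ = decide 1 (Critical.F-zero critical₁ t) ¬u₁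
  stable 2 _ = stableFrom-≤ 1≤N (stopped-region 2 s (¬unstopped₂ s 3∤s))
  stable (suc (suc (suc _))) (s≤s (s≤s (s≤s ())))

-- Parameters without nontrivial fixed points

module _ {r c} (critical : Critical r c) (q : ℤ[ 3 ]) (u : q ∈U 1) where
  open Critical critical

  thirds : ∀ {n} → 1 ≤ n → ∃[ s ] (T q n ≡ + 3 * s)
  thirds 1≤n with ϖ∣T q u 1≤n
  ... | divides s e = s , trans e (ℤₚ.*-comm s (+ 3))

  residue⇒c : ∀ c′ → c ≡ + c′ → q ≡ fromℕ (1 ℕ.+ 3 ℕ.* c′) [mod^ 2 ] →
              ∀ {n} → 2 ≤ n → ∀ s → T q n ≡ + 3 * s → + 3 ∣ s - c
  residue⇒c c′ refl q≡ {n} 2≤n s e = ϖ^-cancel 1 (subst (+ 9 ∣_) (trans (cong₂ _-_ e Tc) (eq′ s (+ c′)))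
    (∣-diff-trans (T q n) (T q 2) (T (fromℕ (1 ℕ.+ 3 ℕ.* c′)) 2) (T-coherent q 2≤n)
      (subst (+ 9 ∣_) (sym (T-diff q (fromℕ (1 ℕ.+ 3 ℕ.* c′)) 2 2)) (mod⇒∣ 2 q≡))))
    where
    eq : ∀ c → + 1 + + 3 * c - + 1 ≡ + 3 * c
    eq = solve-∀
    eq′ : ∀ s c → + 3 * s - + 3 * c ≡ + 3 * (s - c)
    eq′ = solve-∀
    Tc : T (fromℕ {3} (1 ℕ.+ 3 ℕ.* c′)) 2 ≡ + 3 * + c′
    Tc = trans (cong (_- + 1) (trans (ℤₚ.pos-+ 1 (3 ℕ.* c′)) (cong (_+_ (+ 1)) (ℤₚ.pos-* 3 c′)))) (eq (+ c′))

  thirds-diff : ∀ {m n s s′} → T q m ≡ + 3 * s → T q n ≡ + 3 * s′ → ∀ {k} → k ≤ m → k ≤ n →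
                ϖ ^ k ∣ + 3 * (s - s′)
  thirds-diff {m} {n} {s} {s′} e e′ {k} k≤m k≤n =
    subst (ϖ ^ k ∣_) (trans (cong₂ _-_ e e′) (eq s s′))
      (∣-diff-trans (T q m) (T q k) (T q n) (T-coherent q k≤m)
        (∣-diff-sym (T q n) (T q k) (T-coherent q k≤n)))
    where
    eq : ∀ s s′ → + 3 * s - + 3 * s′ ≡ + 3 * (s - s′)
    eq = solve-∀

  module _ (s≡c : ∀ {n} → 2 ≤ n → ∀ s → T q n ≡ + 3 * s → + 3 ∣ s - c) where

    -- A stopped stage has, besides the zero at 0, a zero y₀ that is a unit;
    -- lifted by Hensel's lemma it yields the fixed point r + 3ⁱy of ι_q.
    module NontrivialFixedPoint (k : ℕ) (stopped : ∀ {n} → suc (suc (suc k)) ≤ n → ∀ s → T q n ≡ + 3 * s →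
        (3∤s : ¬ + 3 ∣ s) → Σ[ un ∈ Unstopped r s (suc k) ] ¬ + 3 ∣ Stage.β r s 3∤s k un) where

      i = suc k

      -- The precision reached with `j + 1` digits of `y`: `i` digits come from the factor `3ⁱ` in
      -- front of `H`, and `i + 1` from the valuation of the derivative of `H`.
      level : ℕ → ℕ
      level j = i ℕ.+ (suc j ℕ.+ suc i)

      level-suc : ∀ j → level (suc j) ≡ suc (level j)
      level-suc j = ℕₚ.+-suc i (suc j ℕ.+ suc i)

      level-≥ : ∀ j → suc (suc i) ≤ level j
      level-≥ j = ℕₚ.≤-trans (s≤s (ℕₚ.m≤n+m (suc i) j)) (ℕₚ.m≤n+m _ i)

      point : ℕ → ℕ
      point y = r ℕ.+ 3 ℕ.^ i ℕ.* y

      Root : ℕ → ℕ → Set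
      Root j y = ϖ ^ level j ∣ F (T q (level j)) (point y)

      module AtLevel {n} (n≥ : suc (suc i) ≤ n) where

        s : ℤ
        s = proj₁ (thirds (ℕₚ.≤-trans (s≤s z≤n) n≥))

        T≡ : T q n ≡ + 3 * s
        T≡ = proj₂ (thirds (ℕₚ.≤-trans (s≤s z≤n) n≥))

        3∤s′ : ¬ + 3 ∣ s
        3∤s′ = c⇒3∤s (s≡c (ℕₚ.≤-trans (s≤s (s≤s z≤n)) n≥) s T≡)

        open Stage r s 3∤s′ k public using (v; t≡; 3∣t; 9∣3^)
        un = proj₁ (stopped n≥ s T≡ 3∤s′)
        ¬β = proj₂ (stopped n≥ s T≡ 3∤s′)
        α = Stage.α r s 3∤s′ k un
        β = Stage.β r s 3∤s′ k un
        A≡ = Stage.A≡ r s 3∤s′ k un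

        F≡ : ∀ y → F (T q n) (point y) ≡ ϖ ^ i * H r s i y
        F≡ y = trans (cong (λ t → F t (point y)) T≡) (F-H₀ r s i y (F-zero (+ 3 * s)))

        H⇒F : ∀ m y → ϖ ^ m ∣ H r s i y → ϖ ^ (i ℕ.+ m) ∣ F (T q n) (point y)
        H⇒F m y d = subst₂ _∣_ (sym (ℤₚ.^-distribˡ-+-* (+ 3) i m)) (sym (F≡ y)) (*-monoʳ-∣ (ϖ ^ i) d)

        F⇒H : ∀ m y → ϖ ^ (i ℕ.+ m) ∣ F (T q n) (point y) → ϖ ^ m ∣ H r s i y
        F⇒H m y d = ϖ^-cancel i (subst₂ _∣_ (ℤₚ.^-distribˡ-+-* (+ 3) i m) (F≡ y) d)

      module L₀ = AtLevel (level-≥ 0)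

      y₀-root : ∃[ y ] (y < 3 × + 3 ∣ L₀.β + L₀.v * + y)
      y₀-root = linear-root L₀.β L₀.v (Stage.3∤v r L₀.s L₀.3∤s′ k)

      y₀ : ℕ
      y₀ = proj₁ y₀-root

      3∣β+vy₀ : + 3 ∣ L₀.β + L₀.v * + y₀
      3∣β+vy₀ = proj₂ (proj₂ y₀-root)

      3∤y₀ : ¬ + 3 ∣ + y₀
      3∤y₀ 3∣y₀ = L₀.¬β (subst (+ 3 ∣_) (eq L₀.β (L₀.v * + y₀)) (∣m∣n⇒∣m-n 3∣β+vy₀ (∣n⇒∣m*n L₀.v 3∣y₀)))
        where
        eq : ∀ a b → a + b - b ≡ a
        eq = solve-∀

      start : Root 0 y₀
      start = L₀.H⇒F (suc (suc i)) y₀ (cancel-∤ (suc (suc i)) (H r L₀.s i y₀) 3∤2 root)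
        where
        quad = h-quadratic 3∣9 quadratic₃ L₀.α L₀.v L₀.9∣3^ L₀.A≡ L₀.t≡ y₀
        root : ϖ ^ suc (suc i) ∣ + 2 * H r L₀.s i y₀
        root = subst (ϖ ^ suc (suc i) ∣_) (sym (proj₂ quad))
          (∣m∣n⇒∣m+n (ϖ∣⇒ϖ^suc∣ (suc i) (+ y₀ * (L₀.β + L₀.v * + y₀)) (∣n⇒∣m*n (+ y₀) 3∣β+vy₀))
                     (ϖ^∣ϖ^* (suc (suc i)) (proj₁ quad)))

      abstract
        -- The two levels use different integers for `q - 1`. They agree to the precision of the old
        -- level, so the old root is first carried over to the new parameter and only then lifted.
        extend : ∀ j y → Root j y → ∃[ e ] Root (suc j) (y ℕ.+ 3 ℕ.^ suc j ℕ.* e)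
        extend j y root = proj₁ lifted ,
          H⇒F (suc (suc j ℕ.+ suc i)) y′ (cancel-∤ (suc (suc j ℕ.+ suc i)) (H r s i y′) 3∤2 (proj₂ lifted))
          where
          open AtLevel (level-≥ (suc j))
          level≤ : level j ≤ level (suc j)
          level≤ = ℕₚ.≤-trans (ℕₚ.n≤1+n _) (ℕₚ.≤-reflexive (sym (level-suc j)))
          root-H : ϖ ^ (suc j ℕ.+ suc i) ∣ + 2 * H r s i y
          root-H = ∣n⇒∣m*n (+ 2) (F⇒H (suc j ℕ.+ suc i) y (F-cong (level j) (point y) (T-coherent q level≤) root))
          lifted : ∃[ e ] (ϖ ^ suc (suc j ℕ.+ suc i) ∣ + 2 * H r s i (y ℕ.+ 3 ℕ.^ suc j ℕ.* e))
          lifted = lift-root (λ x → + 2 * H r s i x) (suc i) (suc j)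
            (periodic-* (H r s i) (+ 2) (h-periodic (slope r s i) (+ 3 * τ s i) 3∣t))
            (h-liftable 3∣9 quadratic₃ (suc i) α v 9∣3^ A≡ t≡ ¬β (suc j) (s≤s z≤n)) y root-H
          y′ : ℕ
          y′ = y ℕ.+ 3 ℕ.^ suc j ℕ.* proj₁ lifted

      roots-seq : ∀ j → ∃[ y ] Root j y
      roots-seq zero    = y₀ , start
      roots-seq (suc j) = let y , root = roots-seq j; e , root′ = extend j y root in
        y ℕ.+ 3 ℕ.^ suc j ℕ.* e , root′

      y : ℕ → ℕ
      y j = proj₁ (roots-seq j)

      y-suc : ∀ j → ϖ ^ suc j ∣ + y (suc j) - + y j
      y-suc j = divides (+ e) (trans (cong (λ a → a - + y j) pos-y) (eq (+ y j) (ϖ ^ suc j) (+ e)))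
        where
        e = proj₁ (extend j (y j) (proj₂ (roots-seq j)))
        pos-y : + y (suc j) ≡ + y j + ϖ ^ suc j * + e
        pos-y = trans (ℤₚ.pos-+ (y j) (3 ℕ.^ suc j ℕ.* e)) (cong (λ a → + y j + a) (pos-^* (suc j) e))
        eq : ∀ y w e → y + w * e - y ≡ e * w
        eq = solve-∀

      3∤y : ∀ j → ¬ + 3 ∣ + y j
      3∤y zero    = 3∤y₀
      3∤y (suc j) d = 3∤y j (∣-cancel-term′ (∣-trans (∣m⇒∣m*n (ϖ ^ j) ∣-refl) (y-suc j)) d)

      pos-point : ∀ y → + point y ≡ + r + ϖ ^ i * + y
      pos-point y = trans (ℤₚ.pos-+ r _) (cong (_+_ (+ r)) (pos-^* i y))

      z : ℤ[ 3 ]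
      z = record
        { res      = λ n → point (y n)
        ; coherent = λ n → ∣⇒mod n (subst (ϖ ^ n ∣_)
            (trans (eq (+ r) (ϖ ^ i) (+ y (suc n)) (+ y n)) (cong₂ _-_ (sym (pos-point (y (suc n)))) (sym (pos-point (y n)))))
            (∣n⇒∣m*n (ϖ ^ i) (∣-weaken (ℕₚ.n≤1+n n) (y-suc n))))
        }
        where
        eq : ∀ r w a b → w * (a - b) ≡ r + w * a - (r + w * b)
        eq = solve-∀

      z-fixed : ι q u z ≈ z
      z-fixed n = ∣⇒mod n (subst (ϖ ^ n ∣_) (sym (geomℕ-F q n (point (y n))))
        (F-cong n (point (y n)) (∣-diff-sym (T q (level n)) (T q n) (T-coherent q n≤)) (∣-weaken n≤ (proj₂ (roots-seq n)))))
        where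
        n≤ : n ≤ level n
        n≤ = ℕₚ.≤-trans (ℕₚ.n≤1+n n) (ℕₚ.≤-trans (ℕₚ.m≤m+n (suc n) (suc i)) (ℕₚ.m≤n+m _ i))

      z≢r : ¬ (z ≈ fromℕ r)
      z≢r z≈r = 3∤y (suc i) (ϖ^-cancel i (subst₂ _∣_ (ℤₚ.*-comm (+ 3) (ϖ ^ i))
        (trans (cong (_- + r) (pos-point (y (suc i)))) (eq (+ r) (ϖ ^ i * + y (suc i)))) (mod⇒∣ (suc i) (z≈r (suc i)))))
        where
        eq : ∀ r a → r + a - r ≡ a
        eq = solve-∀

      z≈⇒3∣ : ∀ c → z ≈ fromℕ c → + 3 ∣ + r - + c
      z≈⇒3∣ c z≈c = subst (+ 3 ∣_)
        (trans (cong (λ x → x - + c - ϖ ^ i * + y 1) (pos-point (y 1))) (eq (+ r) (ϖ ^ i * + y 1) (+ c)))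
        (∣m∣n⇒∣m-n (mod⇒∣ 1 (z≈c 1)) (∣m⇒∣m*n (+ y 1) (∣m⇒∣m*n (ϖ ^ k) ∣-refl)))
        where
        eq : ∀ r a c → r + a - c - a ≡ r - c
        eq = solve-∀

      -- `z - r` is `3ⁱ` times a unit with `i ≥ 1`. So `z` differs from `r` and, being congruent to
      -- `r` modulo 3, also from the other one of 0 and 1.
      nontrivial : ¬ NoNontrivialFixedPoint q u
      nontrivial none = none (z , z-fixed , z≢0 , z≢1)
        where
        z≢0 : ¬ (z ≈ fromℕ 0)
        z≢0 z≈ with r≡0⊎1
        ... | inj₁ refl = z≢r z≈
        ... | inj₂ refl = from-no (+ 3 ∣? + 1) (z≈⇒3∣ 0 z≈)
        z≢1 : ¬ (z ≈ fromℕ 1)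
        z≢1 z≈ with r≡0⊎1
        ... | inj₁ refl = from-no (+ 3 ∣? - + 1) (z≈⇒3∣ 1 z≈)
        ... | inj₂ refl = z≢r z≈

    module _ (none : NoNontrivialFixedPoint q u) where

      UnstoppedAt : ℕ → Set
      UnstoppedAt i = ∀ {n} → suc (suc i) ≤ n → ∀ s → T q n ≡ + 3 * s → Unstopped r s (suc i)

      never-stops-step : ∀ i → UnstoppedAt i → UnstoppedAt (suc i)
      never-stops-step i unstopped {n} n≥ s e = continue (+ 3 ∣? Stage.β r s 3∤s i u₀)
        where
        s≡c′ : ∀ {n} → suc (suc (suc i)) ≤ n → ∀ s → T q n ≡ + 3 * s → + 3 ∣ s - c
        s≡c′ n≥ = s≡c (ℕₚ.≤-trans (s≤s (s≤s z≤n)) n≥)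
        unstopped′ : ∀ {n} → suc (suc (suc i)) ≤ n → ∀ s → T q n ≡ + 3 * s → Unstopped r s (suc i)
        unstopped′ n≥ = unstopped (ℕₚ.≤-trans (ℕₚ.n≤1+n (suc (suc i))) n≥)
        3∤s : ¬ + 3 ∣ s
        3∤s = c⇒3∤s (s≡c′ n≥ s e)
        u₀ : Unstopped r s (suc i)
        u₀ = unstopped′ n≥ s e
        stopped : ¬ + 3 ∣ Stage.β r s 3∤s i u₀ → ∀ {n} → suc (suc (suc i)) ≤ n → ∀ s → T q n ≡ + 3 * s →
          (3∤s : ¬ + 3 ∣ s) → Σ[ un ∈ Unstopped r s (suc i) ] ¬ + 3 ∣ Stage.β r s 3∤s i un
        -- `¬β` is known for a single truncation of `q` and is needed for all. Divisibility of `β`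
        -- by 3 amounts to the next stage being unstopped, which depends on `q` modulo `3ⁱ⁺³` only.
        stopped ¬β n′≥ s′ e′ 3∤s′ = u′ , λ 3∣β′ → ¬β (Stage.unstopped⇒3∣β r s 3∤s i u₀
          (unstopped-cong (c⇒slopeDiff s′ s (s≡c′ n′≥ s′ e′) (s≡c′ n≥ s e))
            (thirds-diff e′ e n′≥ n≥) (suc i) ℕₚ.≤-refl (Stage.3∣β⇒unstopped r s′ 3∤s′ i u′ 3∣β′)))
          where
          u′ : Unstopped r s′ (suc i)
          u′ = unstopped′ n′≥ s′ e′
        continue : Dec (+ 3 ∣ Stage.β r s 3∤s i u₀) → Unstopped r s (suc (suc i))
        continue (yes 3∣β) = Stage.3∣β⇒unstopped r s 3∤s i u₀ 3∣β
        continue (no ¬β)   =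
          contradiction none (NontrivialFixedPoint.nontrivial i (stopped ¬β))

      never-stops : ∀ i → UnstoppedAt i
      never-stops zero    n≥ s e = c⇒unstopped s (s≡c n≥ s e)
      never-stops (suc i) = never-stops-step i (never-stops i)

      -- With `i = k + 1`, the quadratic approximation makes `Hᵢ` divisible by `3ⁱ⁺¹` everywhere,
      -- hence `F` by `3²ⁱ⁺¹` on the whole progression; this is where `m ≤ i + 1` comes from. Among
      -- the classes modulo `3ⁱ`, that of `r` alone contributes `3ᵐ`.
      count-≥ : ∀ k m → suc (suc k) ≤ suc k ℕ.+ m → m ≤ suc (suc k) →
                3 ℕ.^ m ≤ roots (F (T q (suc k ℕ.+ m))) (suc k ℕ.+ m) (suc k ℕ.+ m)
      count-≥ k m n≥ m≤ = ℕₚ.≤-trans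
        (ℕₚ.≤-trans (ℕₚ.≤-reflexive (sym (trans (sumTo-cong (3 ℕ.^ m) λ y _ →
            indicator-true (ϖ ^ n ∣? F (T q n) (r ℕ.+ 3 ℕ.^ i ℕ.* y)) (all-roots y))
            (trans (sumTo-const 1 (3 ℕ.^ m)) (ℕₚ.*-identityʳ _)))))
          (term≤sumTo _ (3 ℕ.^ i) r r<))
        (ℕₚ.≤-reflexive (sym (trans (cong (sumTo (λ x → indicator (ϖ ^ n ∣? F (T q n) x))) (ℕₚ.^-distribˡ-+-* 3 i m))
          (sumTo-split _ (3 ℕ.^ i) (3 ℕ.^ m)))))
        where
        i = suc k
        n = i ℕ.+ m
        s = proj₁ (thirds (ℕₚ.≤-trans (s≤s z≤n) n≥))
        e = proj₂ (thirds (ℕₚ.≤-trans (s≤s z≤n) n≥))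
        3∤s′ = c⇒3∤s (s≡c (ℕₚ.≤-trans (s≤s (s≤s z≤n)) n≥) s e)
        un = never-stops k n≥ s e
        open Stage r s 3∤s′ k using (v; t≡; 9∣3^; α; A≡)
        r< : r < 3 ℕ.^ i
        r< = ℕₚ.<-≤-trans (r<3 r≡0⊎1) (ℕₚ.m≤m*n 3 (3 ℕ.^ k) {{ℕₚ.m^n≢0 3 k}})
          where
          r<3 : r ≡ 0 ⊎ r ≡ 1 → r < 3
          r<3 (inj₁ refl) = s≤s z≤n
          r<3 (inj₂ refl) = s≤s (s≤s z≤n)
        all-H : ∀ y → ϖ ^ suc i ∣ H r s i y
        all-H y = cancel-∤ (suc i) (H r s i y) 3∤2 (subst (ϖ ^ suc i ∣_) (sym (proj₂ quad))
          (∣m∣n⇒∣m+n (ϖ^∣ϖ^* (suc i) (+ y * (+ 2 * α un - v + v * + y)))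
                     (∣-weaken (ℕₚ.n≤1+n (suc i)) (ϖ^∣ϖ^* (suc (suc i)) (proj₁ quad)))))
          where quad = h-quadratic 3∣9 quadratic₃ (α un) v 9∣3^ (A≡ un) t≡ y
        all-roots : ∀ y → ϖ ^ n ∣ F (T q n) (r ℕ.+ 3 ℕ.^ i ℕ.* y)
        all-roots y = ∣-weaken (ℕₚ.+-monoʳ-≤ i m≤) (subst₂ _∣_
          (sym (ℤₚ.^-distribˡ-+-* (+ 3) i (suc i)))
          (sym (trans (cong (λ t → F t (r ℕ.+ 3 ℕ.^ i ℕ.* y)) e) (F-H₀ r s i y (F-zero (+ 3 * s)))))
          (*-monoʳ-∣ (ϖ ^ i) (all-H y)))

      -- Taking `i` and `m` to be the two halves of `n`, the larger one for `m`, meets `m ≤ i + 1`.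
      -- The surplus in `suc B` makes `i` positive.
      roots-≥ : ∀ B n → suc B ℕ.+ suc B ≤ n → B ≤ roots (F (T q n)) n n
      roots-≥ B n 2B≤n = subst (λ n → B ≤ roots (F (T q n)) n n) (ℕₚ.⌊n/2⌋+⌈n/2⌉≡n n)
        (from-half ⌊ n /2⌋ ⌈ n /2⌉ B<half (ℕₚ.⌊n/2⌋≤⌈n/2⌉ n)
          (ℕₚ.⌊n/2⌋-mono (ℕₚ.n≤1+n (suc n))))
        where
        B<half : suc B ≤ ⌊ n /2⌋
        B<half = subst (_≤ ⌊ n /2⌋) (sym (ℕₚ.n≡⌊n+n/2⌋ (suc B))) (ℕₚ.⌊n/2⌋-mono 2B≤n)
        from-half : ∀ a b → suc B ≤ a → a ≤ b → b ≤ suc a → B ≤ roots (F (T q (a ℕ.+ b))) (a ℕ.+ b) (a ℕ.+ b)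
        from-half (suc k) b@(suc b′) (s≤s B≤k) (s≤s k≤b′) b≤ = ℕₚ.≤-trans
          (ℕₚ.≤-trans (ℕₚ.≤-trans B≤k (ℕₚ.m≤n⇒m≤1+n k≤b′)) (n≤3^n b))
          (count-≥ k b (s≤s (ℕₚ.≤-trans (s≤s (ℕₚ.m≤m+n k b′)) (ℕₚ.≤-reflexive (sym (ℕₚ.+-suc k b′))))) b≤)

-- Growth at `q₀` and `q₁`, stability elsewhere

exceptional-grows : ∀ {r c} (critical : Critical r c) (q₀ : ℤ[ 3 ]) (u₀ : q₀ ∈U 1) →
  (∀ {n} → 2 ≤ n → ∀ s → T q₀ n ≡ + 3 * s → + 3 ∣ s - c) → NoNontrivialFixedPoint q₀ u₀ →
  ∀ q u → q ≈ q₀ → GrowsWithoutBound (#Fixed q u)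
exceptional-grows critical q₀ u₀ s≡c none q u q≈q₀ B = suc B ℕ.+ suc B , λ n N≤n →
  subst (B ≤_) (sym (trans (#Fixed≡roots q u n)
      (roots-F-cong n (subst (ϖ ^ n ∣_) (sym (T-diff q q₀ n n)) (mod⇒∣ n (q≈q₀ n))))))
    (roots-≥ critical q₀ u₀ s≡c none B n N≤n)

-- `q₀` is unstopped at every stage. If `q` were unstopped at stage `f + 1` as well, the two would
-- agree modulo `3^(f+2)`, although they differ modulo `3ᵐ` with `m ≤ f`.
unexceptional-stops : ∀ {r c} (critical : Critical r c) (q₀ : ℤ[ 3 ]) (u₀ : q₀ ∈U 1) →
  (∀ {n} → 2 ≤ n → ∀ s → T q₀ n ≡ + 3 * s → + 3 ∣ s - c) → NoNontrivialFixedPoint q₀ u₀ →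
  ∀ q {m} → ¬ (q ≡ q₀ [mod^ m ]) → ∀ {f n s} → m ≤ f → suc (suc f) ≤ n → T q n ≡ + 3 * s → ¬ + 3 ∣ s →
  Unstopped r s 1 → ¬ Unstopped r s (f ℕ.+ 1)
unexceptional-stops {r} {c} critical q₀ u₀ s≡c none q {m} q#q₀ {f} {n} {s} m≤f f<n e 3∤s u u′ =
  #⇒∤ {q = q} {q₀} q#q₀ (ℕₚ.≤-trans m≤f (ℕₚ.≤-trans (ℕₚ.n≤1+n f) (ℕₚ.≤-trans (ℕₚ.n≤1+n (suc f)) f<n)))
    (subst (ϖ ^ m ∣_) (sym (trans (cong₂ _-_ e e₀) (eq s s₀)))
      (∣-weaken (ℕₚ.≤-trans m≤f (ℕₚ.≤-trans (ℕₚ.n≤1+n f) (ℕₚ.n≤1+n (suc f))))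
        (unstopped-unique {r} {s} {s₀}
          (c⇒slopeDiff s s₀ (unstopped⇒c s 3∤s u) (s≡c (ℕₚ.≤-trans (s≤s (s≤s z≤n)) f<n) s₀ e₀)) f
          (subst (Unstopped r s) (ℕₚ.+-comm f 1) u′)
          (never-stops critical q₀ u₀ s≡c none f f<n s₀ e₀))))
  where
  open Critical critical
  s₀ = proj₁ (thirds critical q₀ u₀ {n} (ℕₚ.≤-trans (s≤s z≤n) f<n))
  e₀ = proj₂ (thirds critical q₀ u₀ {n} (ℕₚ.≤-trans (s≤s z≤n) f<n))
  eq : ∀ s s′ → + 3 * s - + 3 * s′ ≡ + 3 * (s - s′)
  eq = solve-∀

stable₃ : (q₀ q₁ : ℤ[ 3 ]) → IsExceptional 7 q₀ → IsExceptional 4 q₁ →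
  (q : ℤ[ 3 ]) (u : q ∈U 1) → q # fromℕ 1 → q # q₀ → q # q₁ → AsymptoticallyStable (#Fixed q u)
stable₃ q₀ q₁ (u₀ , _ , q₀≡7 , none₀) (u₁ , _ , q₁≡4 , none₁) q u (l , q#1) (m₀ , q#q₀) (m₁ , q#q₁) =
  #Fixed-stable q u N stable
  where
  -- A single bound on the number of stages serves both critical residues.
  f = m₀ ℕ.+ m₁
  N = 4 ℕ.+ (f ℕ.+ f) ℕ.+ l
  stable : ∀ n → N ≤ n → StableFrom N (λ k → roots (F (T q n)) k k)
  stable n N≤n with T-valuation q u q#1 (ℕₚ.≤-trans (s≤s z≤n) N≤n) (ℕₚ.≤-trans (ℕₚ.m≤n+m l (4 ℕ.+ (f ℕ.+ f))) N≤n)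
  -- Here `9` divides `T q n`, and the argument for the other primes applies without any descent.
  ... | suc m , v , m<l , e , ¬v = stableFrom-≤ (ℕₚ.≤-trans m<l (ℕₚ.m≤n+m l (4 ℕ.+ (f ℕ.+ f))))
    (roots-F-stable 3∣9 quadratic₃ 3∤2 (suc m) v (ϖ^∣ϖ^ {2} {suc (suc m)} (s≤s (s≤s z≤n))) e ¬v)
  ... | zero , v , _ , e , ¬v = subst (λ t → StableFrom N (λ k → roots (F t) k k)) (sym e)
    (stableFrom-≤ (ℕₚ.m≤m+n (4 ℕ.+ (f ℕ.+ f)) l) (fixed-stable₃ v ¬v f
      (unexceptional-stops critical₀ q₀ u₀ (residue⇒c critical₀ q₀ u₀ 2 refl q₀≡7) none₀
        q q#q₀ (ℕₚ.m≤m+n m₀ m₁) f<n e ¬v)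
      (unexceptional-stops critical₁ q₁ u₁ (residue⇒c critical₁ q₁ u₁ 1 refl q₁≡4) none₁
        q q#q₁ (ℕₚ.m≤n+m m₁ m₀) f<n e ¬v)))
    where
    f<n : suc (suc f) ≤ n
    f<n = ℕₚ.≤-trans (s≤s (s≤s (ℕₚ.≤-trans (ℕₚ.m≤m+n f f) (ℕₚ.≤-trans (ℕₚ.m≤n+m (f ℕ.+ f) 2) (ℕₚ.m≤m+n (2 ℕ.+ (f ℕ.+ f)) l))))) N≤n

corollary6p4 : ((p : ℕ) → Prime p → p ≢ 3 →
    (q : ℤ[ p ]) (u : q ∈U 1) → q # fromℕ 1 →
    AsymptoticallyStable (#Fixed q u))
    ×
    ((q₀ q₁ : ℤ[ 3 ]) → IsExceptional 7 q₀ → IsExceptional 4 q₁ →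
    ((q : ℤ[ 3 ]) (u : q ∈U 1) → q # fromℕ 1 → q # q₀ → q # q₁ →
    AsymptoticallyStable (#Fixed q u))
    ×
    ((q : ℤ[ 3 ]) (u : q ∈U 1) → (q ≈ q₀ ⊎ q ≈ q₁) →
    GrowsWithoutBound (#Fixed q u)))
corollary6p4 = stable , λ q₀ q₁ exc₀ exc₁ → stable₃ q₀ q₁ exc₀ exc₁ , grows q₀ q₁ exc₀ exc₁
  where
  stable : (p : ℕ) → Prime p → p ≢ 3 → (q : ℤ[ p ]) (u : q ∈U 1) → q # fromℕ 1 →
           AsymptoticallyStable (#Fixed q u)
  stable p pr p≢3 with p ℕₚ.≟ 2
  ... | yes refl = stable₂
  ... | no p≢2   = stable₅ p pr p≢2 p≢3
  grows : (q₀ q₁ : ℤ[ 3 ]) → IsExceptional 7 q₀ → IsExceptional 4 q₁ →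
          (q : ℤ[ 3 ]) (u : q ∈U 1) → (q ≈ q₀ ⊎ q ≈ q₁) → GrowsWithoutBound (#Fixed q u)
  grows q₀ q₁ (u₀ , _ , q₀≡7 , none₀) (u₁ , _ , q₁≡4 , none₁) q u = [
    exceptional-grows critical₀ q₀ u₀ (residue⇒c critical₀ q₀ u₀ 2 refl q₀≡7) none₀ q u ,
    exceptional-grows critical₁ q₁ u₁ (residue⇒c critical₁ q₁ u₁ 1 refl q₁≡4) none₁ q u ]′
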